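{- For a positive integer $n$, let $A(n)$ denote the number of partitions of $n$ into parts $\equiv \pm 1,\pm 3 \pmod 7$. Let $B(n)$ denote the number of bipartitions $(\pi,\lambda)$ of $n$, where $\pi$ is a partition into distinct even parts greater than $2$ with a gap of at least $4$ between consecutive parts, and $\lambda$ is a partition into distinct parts such that if $e_j$ is the $j$-th part in $\pi$ (where the parts are ordered in ascending order), then the parts $e_j/2-1$, $e_j/2$ and $e_j/2+1$ are not present in $\lambda$. Let $C(n)$ denote the number of bipartitions $(\pi,\mu)$ of $n$, where $\pi$ is a partition into distinct even parts greater than $2$ with a gap of at least $4$ between consecutive parts, and $\mu$ is a partition into distinct parts such that if $e_j$ is the $j$-th part in $\pi$ (where the parts are ordered in ascending order), then the parts $e_j/2+j-2$, $e_j/2+j-1$ and $e_j/2+j$ are not present in $\mu$. Then $A(n)=B(n)=C(n)$ for every positive integer $n$.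
   Context: The union $\pi\cup\lambda$ of partitions $\pi$ and $\lambda$ is the partition whose parts are those of $\pi$ and $\lambda$ together (with multiplicity), arranged in non-increasing order. A bipartition of a positive integer $n$ is an ordered pair of partitions $(\pi,\lambda)$ such that $\pi\cup\lambda$ is a partition of $n$; $\pi$ or $\lambda$ may be empty. The exclusion conditions are imposed for every part $e_j$ of $\pi$, where $e_1<e_2<\cdots$ are the parts of $\pi$. -}

module Defs where

open import Data.Empty using (⊥-elim)
open import Data.Fin.Base using (Fin; toℕ)
open import Data.Fin.Properties using () renaming (all? to allFin?)
open import Data.Integer.Base as ℤ using (ℤ; +_)
import Data.Integer.Divisibility as ℤ using (_∣_)
open import Data.List.Base
  using (List; []; _∷_; _++_; map; filter; length; lookup; reverse; merge; cartesianProduct)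
open import Data.List.Membership.Propositional using (_∈_; _∉_)
open import Data.List.Membership.Propositional.Properties
  using (∈-++⁺ˡ; ∈-++⁺ʳ; ∈-++⁻; ∈-map⁺; ∈-map⁻; ∈-filter⁺; ∈-filter⁻; ∈-cartesianProduct⁺)
open import Data.List.Properties using (∷-injectiveʳ)
open import Data.List.Membership.Propositional.Properties.WithK using (unique∧set⇒bag)
open import Data.List.Relation.Binary.BagAndSetEquality using (∼bag⇒↭)
open import Data.List.Relation.Binary.Disjoint.Propositional using (Disjoint)
open import Data.List.Relation.Binary.Permutation.Propositional.Properties
  using (↭-length; merge-↭)
open import Data.List.Relation.Unary.All as All using (All; []; _∷_; all?)
open import Data.List.Relation.Unary.AllPairs using ([]; _∷_)
open import Data.List.Relation.Unary.Any using (here)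
open import Data.List.Relation.Unary.Linked as Linked using (Linked; linked?)
open import Data.List.Relation.Unary.Unique.Propositional using (Unique)
open import Data.List.Relation.Unary.Unique.Propositional.Properties
  using (map⁺; ++⁺; filter⁺; cartesianProduct⁺)
open import Data.Nat.Base
open import Data.Nat.Divisibility using (_∣_; _∣?_)
open import Data.Nat.DivMod using (_/_)
open import Data.Nat.ListAction using (sum)
open import Data.Nat.ListAction.Properties using (sum-++; sum-↭)
open import Data.Nat.Properties
open import Data.List.Membership.DecPropositional _≟_ using (_∈?_)
open import Data.List.Relation.Unary.Unique.DecPropositional _≟_ using (unique?)
open import Data.Product.Base using (_×_; _,_; proj₁; proj₂)
open import Data.Sum.Base using (_⊎_; inj₁; inj₂)
open import Function.Base using (_∘_)
open import Function.Bundles using (mk⇔)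
open import Relation.Binary.PropositionalEquality
open import Relation.Nullary using (Dec; yes; no; ¬?; _×-dec_; _⊎-dec_)
open import Relation.Unary using (Decidable)

record Enumeration {X : Set} (P : X → Set) : Set where
  field
    elements : List X
    unique   : Unique elements
    sound    : ∀ {x} → x ∈ elements → P x
    complete : ∀ {x} → P x → x ∈ elements

open Enumeration

-- The cardinality of { x | P x }.
number : ∀ {X : Set} {P : X → Set} → Enumeration P → ℕ
number e = length (elements e)

-- The number depends only on P, not on the way P is enumerated.
number-unique : ∀ {X : Set} {P : X → Set} (e e′ : Enumeration P) → number e ≡ number e′
number-unique e e′ = ↭-length (∼bag⇒↭ (unique∧set⇒bag (unique e) (unique e′)
  (mk⇔ (complete e′ ∘ sound e) (complete e ∘ sound e′))))

restrict : ∀ {X : Set} {P : X → Set} → Decidable P →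
           (xs : List X) → Unique xs → (∀ {x} → P x → x ∈ xs) → Enumeration P
restrict P? xs u c = record
  { elements = filter P? xs
  ; unique   = filter⁺ P? u
  ; sound    = λ x∈ → proj₂ (∈-filter⁻ P? {xs = xs} x∈)
  ; complete = λ p → ∈-filter⁺ P? (c p) p
  }

-- A partition is the list of its parts in non-increasing order.
IsPartition : List ℕ → Set
IsPartition π = All (0 <_) π × Linked _≥_ π

_IsPartitionOf_ : List ℕ → ℕ → Set
π IsPartitionOf n = IsPartition π × sum π ≡ n

-- Merging two non-increasing lists keeps multiplicities and the order.
infixr 6 _∪_
_∪_ : List ℕ → List ℕ → List ℕ
π ∪ σ = merge _≥?_ π σ

_IsBipartitionOf_ : List ℕ × List ℕ → ℕ → Set
(π , σ) IsBipartitionOf n = IsPartition π × IsPartition σ × (π ∪ σ) IsPartitionOf n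

_≡_[mod_] : ℤ → ℤ → ℕ → Set
a ≡ b [mod m ] = (+ m) ℤ.∣ (a ℤ.- b)

_≡±_[mod_] : ℕ → ℕ → ℕ → Set
a ≡± b [mod m ] = (+ a) ≡ (+ b) [mod m ] ⊎ (+ a) ≡ (ℤ.- (+ b)) [mod m ]

DistinctParts : List ℕ → Set
DistinctParts = Unique

EvenGapped : List ℕ → Set
EvenGapped π = DistinctParts π × All (2 ∣_) π × All (2 <_) π × Linked (λ a b → b + 4 ≤ a) π

-- The parts of π in ascending order e₁, e₂, …; the index i : Fin (length …)
-- stands for j = i + 1.
ascending : List ℕ → List ℕ
ascending = reverse

-- For even e_j > 2 (see EvenGapped), e_j / 2 ≥ 2, so no subtraction below is truncated.
AvoidsB : List ℕ → List ℕ → Set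
AvoidsB π σ = ∀ (i : Fin (length (ascending π))) →
  let e = lookup (ascending π) i in
  e / 2 ∸ 1 ∉ σ × e / 2 ∉ σ × e / 2 + 1 ∉ σ

AvoidsC : List ℕ → List ℕ → Set
AvoidsC π σ = ∀ (i : Fin (length (ascending π))) →
  let e = lookup (ascending π) i
      j = suc (toℕ i) in
  e / 2 + j ∸ 2 ∉ σ × e / 2 + j ∸ 1 ∉ σ × e / 2 + j ∉ σ

IsA : ℕ → List ℕ → Set
IsA n π = π IsPartitionOf n × All (λ p → p ≡± 1 [mod 7 ] ⊎ p ≡± 3 [mod 7 ]) π

IsB : ℕ → List ℕ × List ℕ → Set
IsB n (π , σ) = (π , σ) IsBipartitionOf n × EvenGapped π × DistinctParts σ × AvoidsB π σ

IsC : ℕ → List ℕ × List ℕ → Set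
IsC n (π , σ) = (π , σ) IsBipartitionOf n × EvenGapped π × DistinctParts σ × AvoidsC π σ

isPartition? : Decidable IsPartition
isPartition? π = all? (0 <?_) π ×-dec linked? _≥?_ π

_isPartitionOf?_ : ∀ π n → Dec (π IsPartitionOf n)
π isPartitionOf? n = isPartition? π ×-dec (sum π ≟ n)

_isBipartitionOf?_ : ∀ πσ n → Dec (πσ IsBipartitionOf n)
(π , σ) isBipartitionOf? n =
  isPartition? π ×-dec isPartition? σ ×-dec ((π ∪ σ) isPartitionOf? n)

_≡±?_[mod_] : ∀ a b m → Dec (a ≡± b [mod m ])
a ≡±? b [mod m ] = (m ∣? ℤ.∣ (+ a) ℤ.- (+ b) ∣) ⊎-dec (m ∣? ℤ.∣ (+ a) ℤ.- (ℤ.- (+ b)) ∣)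

_∉?_ : ∀ (k : ℕ) σ → Dec (k ∉ σ)
k ∉? σ = ¬? (k ∈? σ)

evenGapped? : Decidable EvenGapped
evenGapped? π = unique? π ×-dec all? (2 ∣?_) π ×-dec all? (2 <?_) π
  ×-dec linked? (λ a b → b + 4 ≤? a) π

avoidsB? : ∀ π σ → Dec (AvoidsB π σ)
avoidsB? π σ = allFin? λ i → (_ ∉? σ) ×-dec (_ ∉? σ) ×-dec (_ ∉? σ)

avoidsC? : ∀ π σ → Dec (AvoidsC π σ)
avoidsC? π σ = allFin? λ i → (_ ∉? σ) ×-dec (_ ∉? σ) ×-dec (_ ∉? σ)

isA? : ∀ n → Decidable (IsA n)
isA? n π = (π isPartitionOf? n)
  ×-dec all? (λ p → (p ≡±? 1 [mod 7 ]) ⊎-dec (p ≡±? 3 [mod 7 ])) π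

isB? : ∀ n → Decidable (IsB n)
isB? n (π , σ) = ((π , σ) isBipartitionOf? n)
  ×-dec evenGapped? π ×-dec unique? σ ×-dec avoidsB? π σ

isC? : ∀ n → Decidable (IsC n)
isC? n (π , σ) = ((π , σ) isBipartitionOf? n)
  ×-dec evenGapped? π ×-dec unique? σ ×-dec avoidsC? π σ

-- bounded f m s: partitions with at most f parts, all ≤ m, and sum ≤ s.
bounded : ℕ → ℕ → ℕ → List (List ℕ)
bounded zero    m       s = [] ∷ []
bounded (suc f) zero    s = [] ∷ []
bounded (suc f) (suc m) s with suc m ≤? s
... | yes _ = bounded (suc f) m s ++ map (suc m ∷_) (bounded f (suc m) (s ∸ suc m))
... | no  _ = bounded (suc f) m s

bounded-head≤ : ∀ f m s {x xs} → (x ∷ xs) ∈ bounded f m s → x ≤ m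
bounded-head≤ zero    m       s (here ())
bounded-head≤ (suc f) zero    s (here ())
bounded-head≤ (suc f) (suc m) s p with suc m ≤? s
... | no _ = m≤n⇒m≤1+n (bounded-head≤ (suc f) m s p)
... | yes _ with ∈-++⁻ (bounded (suc f) m s) p
...   | inj₁ q = m≤n⇒m≤1+n (bounded-head≤ (suc f) m s q)
...   | inj₂ q with ∈-map⁻ (suc m ∷_) q
...     | _ , _ , refl = ≤-refl

bounded-unique : ∀ f m s → Unique (bounded f m s)
bounded-unique zero    m       s = [] ∷ []
bounded-unique (suc f) zero    s = [] ∷ []
bounded-unique (suc f) (suc m) s with suc m ≤? s
... | no  _ = bounded-unique (suc f) m s
... | yes _ = ++⁺ (bounded-unique (suc f) m s)
                  (map⁺ ∷-injectiveʳ (bounded-unique f (suc m) (s ∸ suc m)))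
                  disjoint
  where
  disjoint : Disjoint (bounded (suc f) m s) (map (suc m ∷_) (bounded f (suc m) (s ∸ suc m)))
  disjoint (p , q) with ∈-map⁻ (suc m ∷_) q
  ... | _ , _ , refl = 1+n≰n (bounded-head≤ (suc f) m s p)

[]∈bounded : ∀ f m s → [] ∈ bounded f m s
[]∈bounded zero    m       s = here refl
[]∈bounded (suc f) zero    s = here refl
[]∈bounded (suc f) (suc m) s with suc m ≤? s
... | yes _ = ∈-++⁺ˡ ([]∈bounded (suc f) m s)
... | no  _ = []∈bounded (suc f) m s

head≤ : ∀ {x xs} → Linked _≥_ (x ∷ xs) → ∀ {y ys} → xs ≡ y ∷ ys → y ≤ x
head≤ (y≤x Linked.∷ _) refl = y≤x

bounded-complete : ∀ f m s {π} → IsPartition π → (∀ {y ys} → π ≡ y ∷ ys → y ≤ m) →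
                   length π ≤ f → sum π ≤ s → π ∈ bounded f m s
bounded-complete f m s {[]} _ _ _ _ = []∈bounded f m s
bounded-complete (suc f) zero s {x ∷ π} (0<x ∷ _ , _) h _ _ = ⊥-elim (<⇒≱ 0<x (h refl))
bounded-complete (suc f) (suc m) s {x ∷ π} (0<x ∷ pos , lnk) h (s≤s len) sum≤
  with suc m ≤? s | x ≤? m
... | yes _ | yes x≤m = ∈-++⁺ˡ
        (bounded-complete (suc f) m s (0<x ∷ pos , lnk) (λ { refl → x≤m }) (s≤s len) sum≤)
... | no  _ | yes x≤m =
        bounded-complete (suc f) m s (0<x ∷ pos , lnk) (λ { refl → x≤m }) (s≤s len) sum≤
... | no 1+m≰s | no x≰m = ⊥-elim (1+m≰s (≤-trans (≰⇒> x≰m) (≤-trans (m≤m+n x (sum π)) sum≤)))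
... | yes _ | no x≰m with ≤-antisym (h refl) (≰⇒> x≰m)
...   | refl = ∈-++⁺ʳ (bounded (suc f) m s) (∈-map⁺ (suc m ∷_)
        (bounded-complete f (suc m) (s ∸ suc m) (pos , Linked.tail lnk) (head≤ lnk) len
          (m+n≤o⇒n≤o∸m (suc m) sum≤)))
  where
  m+n≤o⇒n≤o∸m : ∀ a {b c} → a + b ≤ c → b ≤ c ∸ a
  m+n≤o⇒n≤o∸m a {b} p = subst (_≤ _) (m+n∸m≡n a b) (∸-monoˡ-≤ a p)

length≤sum : ∀ {π} → All (0 <_) π → length π ≤ sum π
length≤sum []          = z≤n
length≤sum (0<x ∷ pos) = +-mono-≤ 0<x (length≤sum pos)

partitions≤ : ℕ → List (List ℕ)
partitions≤ n = bounded n n n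

partitions≤-complete : ∀ {n π} → IsPartition π → sum π ≤ n → π ∈ partitions≤ n
partitions≤-complete {n} p sum≤ = bounded-complete n n n p
  (λ { {y} {ys} refl → ≤-trans (m≤m+n y (sum ys)) sum≤ })
  (≤-trans (length≤sum (proj₁ p)) sum≤) sum≤

bipartition∈ : ∀ {n πσ} → πσ IsBipartitionOf n →
               πσ ∈ cartesianProduct (partitions≤ n) (partitions≤ n)
bipartition∈ {n} {π , σ} (p , q , _ , eq) = ∈-cartesianProduct⁺
  (partitions≤-complete p (≤-trans (m≤m+n (sum π) (sum σ)) (≤-reflexive sum-eq)))
  (partitions≤-complete q (≤-trans (m≤n+m (sum σ) (sum π)) (≤-reflexive sum-eq)))
  where
  sum-eq : sum π + sum σ ≡ n
  sum-eq = trans (sym (trans (sum-↭ (merge-↭ _≥?_ π σ)) (sum-++ π σ))) eq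

enumA : ∀ n → Enumeration (IsA n)
enumA n = restrict (isA? n) (partitions≤ n) (bounded-unique n n n)
  λ { ((p , eq) , _) → partitions≤-complete p (≤-reflexive eq) }

enumB : ∀ n → Enumeration (IsB n)
enumB n = restrict (isB? n) (cartesianProduct (partitions≤ n) (partitions≤ n))
  (cartesianProduct⁺ (bounded-unique n n n) (bounded-unique n n n))
  λ { (bip , _) → bipartition∈ bip }

enumC : ∀ n → Enumeration (IsC n)
enumC n = restrict (isC? n) (cartesianProduct (partitions≤ n) (partitions≤ n))
  (cartesianProduct⁺ (bounded-unique n n n) (bounded-unique n n n))
  λ { (bip , _) → bipartition∈ bip }

A : ℕ → ℕ
A n = number (enumA n)

B : ℕ → ℕ
B n = number (enumB n)

C : ℕ → ℕ
C n = number (enumC n)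

{-# OPTIONS --safe #-}
module Submission where

-- Halving the parts of π and reading a part e of π as two copies of e/2 turns the bipartitions
-- counted by B into the Gordon partitions for k = 3, i = 2.  Splitting on whether the least
-- possible part occurs gives, for the generating functions F_d (smallest part of λ at least d) and
-- H_d (at least d + 1),
--   F_d = H_d + q^d F_(d+1),    H_d = F_(d+1) + q^(2d+2) H_(d+2),
-- a system with only one solution tending to 1.
-- For C, let G c d count the configurations in which c parts of π lie below.  One step gives
--   G c d = (1 + q^(c+d)) G c (d+1) + q^(2d+2) G (c+1) (d+2),
-- and a joint backward induction shows that (G 0, G 1) solves the same system, so B = C.
-- Andrews' alternating series J_{3,i} solve it as well, up to the factor (q;q)∞; at d = 1 the series
-- is Σ_{n∈ℤ} (−1)^n q^(n(7n+3)/2), which Jacobi's triple product turns into the product for A.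
-- Everything takes place modulo q^N, so that all sums and products are finite.


-- Truncation also removes every division. With `q` nilpotent each `1 - q * v` is cancellable, so
-- the counts are compared after multiplication by (q;q)∞, and on the side of A only the factors
-- with exponents 0, ±2 modulo 7 survive. The triple product needs no inverse of z either: it uses
-- two nilpotent variables `z` and `w` with `Q = z * w`, so that `w` stands for Q/z. The obstacle in
-- C is that the excluded values depend on how many parts of π lie below. Removing a least part of π
-- changes c, and the recurrence for G never closes on finitely many c. It becomes tractable through
-- the pair G c d = G (c+1) d + q^(c+d) G c (d+1), G (c+1) d = G c (d+1) + q^(2d+2) G (c+1) (d+2).
-- Substituting the second into the first gives back the recurrence, and at c = 0 the pair is the
-- system for F and H, with G 1 in the role of H although it counts different configurations.

open import Defs
open import Algebra.Bundles using (CommutativeRing; RawRing)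
import Algebra.Properties.CommutativeSemigroup
import Algebra.Properties.CommutativeSemiring.Exp
import Algebra.Properties.Ring
import Algebra.Properties.Semiring.Exp
import Algebra.Properties.Semiring.Mult
import Algebra.Properties.Semiring.Sum
import Algebra.Solver.Ring
import Algebra.Solver.Ring.AlmostCommutativeRing as ACR
open import Data.Empty using (⊥-elim)
open import Data.Fin.Base as Fin using (Fin; toℕ)
open import Data.Integer.Base as ℤ using (ℤ; +_; 0ℤ; 1ℤ)
import Data.Integer.Divisibility as ℤ using (_∣_)
import Data.Integer.Divisibility.Signed as Signed
import Data.Integer.Properties as ℤ
open import Data.Integer.Tactic.RingSolver using (solve-∀)
open import Data.List.Base using (List; []; _∷_; _++_; map; length; lookup; reverse)
open import Data.List.Membership.Propositional using (_∈_; _∉_)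
open import Data.List.Membership.Propositional.Properties using (∈-++⁺ˡ; ∈-++⁺ʳ; ∈-++⁻; ∈-map⁺; ∈-map⁻)
open import Data.List.Properties
  using (∷-injectiveʳ; length-map; length-++; unfold-reverse; reverse-involutive; reverse-injective; map-injective)
open import Data.List.Relation.Binary.Permutation.Propositional using (↭-sym)
open import Data.List.Relation.Binary.Permutation.Propositional.Properties using (All-resp-↭; ↭-reverse; merge-↭)
open import Data.List.Relation.Unary.All as All using (All; []; _∷_)
import Data.List.Relation.Unary.All.Properties as All
open import Data.List.Relation.Unary.AllPairs as AllPairs using (AllPairs; []; _∷_)
import Data.List.Relation.Unary.AllPairs.Properties as AllPairs
open import Data.List.Relation.Unary.Any using (here)
open import Data.List.Relation.Unary.Linked as Linked using (Linked; []; [-]; _∷_)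
open import Data.List.Relation.Unary.Linked.Properties using (Linked⇒AllPairs; AllPairs⇒Linked)
open import Data.List.Relation.Unary.Sorted.TotalOrder.Properties using (merge⁺)
import Data.List.Relation.Unary.Unique.Propositional.Properties as Unique
open import Data.Maybe.Base using (Maybe; just; nothing)
open import Data.Nat.Base as ℕ using (ℕ; zero; suc; z≤n; s≤s; NonZero)
open import Data.Nat.Divisibility using (_∣_; m∣m*n)
open import Data.Nat.DivMod using (_/_; m*n/n≡m; m*[n/m]≡n)
open import Data.Nat.ListAction.Properties using (sum-↭; sum-++)
import Data.Nat.Properties as ℕ
open import Data.Nat.Solver using (module +-*-Solver)
open import Data.Product.Base using (_×_; _,_; proj₁; proj₂; ∃)
open import Data.Sum.Base as Sum using (_⊎_; inj₁; inj₂)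
open import Function.Base using (_∘_; const; id; flip)
open import Function.Definitions using (Injective)
open import Level using (0ℓ)
open import Relation.Binary.Core using (Rel)
open import Relation.Binary.Definitions using (tri<; tri≈; tri>)
import Relation.Binary.Construct.Flip.EqAndOrd as Flip
open import Relation.Binary.PropositionalEquality as ≡ using (_≡_; _≢_)
import Relation.Binary.Reasoning.Setoid
open import Relation.Nullary using (¬_; yes; no; _×-dec_; _⊎-dec_; from-yes; from-no)
open import Relation.Unary using (Decidable)

-- Ring identities with integer coefficients

-- A coefficient (a , b) stands for the integer a − b.
module IntegerSolver (R : CommutativeRing 0ℓ 0ℓ) where
  open CommutativeRing R
  open Algebra.Properties.Semiring.Mult semiring using (×-homo-+; ×1-homo-*; ×-homo-1; ×-congˡ)
    renaming (_×_ to _·_)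
  open Algebra.Properties.Ring ring
  open Algebra.Properties.CommutativeSemigroup +-commutativeSemigroup using (interchange)
  open Relation.Binary.Reasoning.Setoid setoid

  private
    Differences : RawRing 0ℓ 0ℓ
    Differences = record
      { Carrier = ℕ × ℕ
      ; _≈_ = _≡_
      ; _+_ = λ { (a , b) (c , d) → a ℕ.+ c , b ℕ.+ d }
      ; _*_ = λ { (a , b) (c , d) → a ℕ.* c ℕ.+ b ℕ.* d , a ℕ.* d ℕ.+ b ℕ.* c }
      ; -_ = λ { (a , b) → b , a }
      ; 0# = 0 , 0
      ; 1# = 1 , 0
      }

    ⟦_⟧ : ℕ × ℕ → Carrier
    ⟦ a , b ⟧ = a · 1# - b · 1#

    -‿homo-+ : ∀ w x y z → (w + x) - (y + z) ≈ (w - y) + (x - z)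
    -‿homo-+ w x y z = trans (+-congˡ (sym (-‿+-comm y z))) (interchange w x (- y) (- z))

    -‿swap : ∀ x y → - (x - y) ≈ y - x
    -‿swap x y = begin
      - (x - y)      ≈⟨ -‿+-comm x (- y) ⟨
      - x + - (- y)  ≈⟨ +-congˡ (-‿involutive y) ⟩
      - x + y        ≈⟨ +-comm (- x) y ⟩
      y - x          ∎

    ⟦⟧-*-homo : ∀ w x y z → (w * y + x * z) - (w * z + x * y) ≈ (w - x) * (y - z)
    ⟦⟧-*-homo w x y z = begin
      (w * y + x * z) - (w * z + x * y)    ≈⟨ -‿homo-+ _ _ _ _ ⟩
      (w * y - w * z) + (x * z - x * y)    ≈⟨ +-cong (x[y-z]≈xy-xz w y z) (-‿swap _ _) ⟨
      w * (y - z) + - (x * y - x * z)      ≈⟨ +-congˡ (-‿cong (x[y-z]≈xy-xz x y z)) ⟨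
      w * (y - z) + - (x * (y - z))        ≈⟨ [y-z]x≈yx-zx _ _ _ ⟨
      (w - x) * (y - z)                    ∎

    ×-homo-dot : ∀ a b c d → (a ℕ.* c ℕ.+ b ℕ.* d) · 1# ≈ (a · 1#) * (c · 1#) + (b · 1#) * (d · 1#)
    ×-homo-dot a b c d = trans (×-homo-+ 1# (a ℕ.* c) (b ℕ.* d)) (+-cong (×1-homo-* a c) (×1-homo-* b d))

    -- The unit coefficient has to denote 1# on the nose for goals mentioning 1# to match.
    ⟦_⟧₁ : ℕ × ℕ → Carrier
    ⟦ 1 , 0 ⟧₁ = 1#
    ⟦ c ⟧₁     = ⟦ c ⟧

    ⟦_⟧-agree : ∀ c → ⟦ c ⟧₁ ≈ ⟦ c ⟧
    ⟦ 0 , _ ⟧-agree               = refl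
    ⟦ 1 , 0 ⟧-agree               = sym (trans (+-congˡ -0#≈0#) (trans (+-identityʳ _) (×-homo-1 1#)))
    ⟦ 1 , suc _ ⟧-agree           = refl
    ⟦ suc (suc _) , _ ⟧-agree     = refl

    ring′ = ACR.fromCommutativeRing R

    morphism : Differences ACR.-Raw-AlmostCommutative⟶ ring′
    morphism = record
      { ⟦_⟧ = ⟦_⟧₁
      ; +-homo = λ { x@(a , b) y@(c , d) → trans ⟦ a ℕ.+ c , b ℕ.+ d ⟧-agree (trans
          (trans (+-cong (×-homo-+ 1# a c) (-‿cong (×-homo-+ 1# b d))) (-‿homo-+ _ _ _ _))
          (sym (+-cong ⟦ x ⟧-agree ⟦ y ⟧-agree))) }
      ; *-homo = λ { x@(a , b) y@(c , d) → trans ⟦ a ℕ.* c ℕ.+ b ℕ.* d , a ℕ.* d ℕ.+ b ℕ.* c ⟧-agree (trans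
          (trans (+-cong (×-homo-dot a b c d) (-‿cong (×-homo-dot a b d c))) (⟦⟧-*-homo _ _ _ _))
          (sym (*-cong ⟦ x ⟧-agree ⟦ y ⟧-agree))) }
      ; -‿homo = λ { x@(a , b) → trans ⟦ b , a ⟧-agree (trans (sym (-‿swap _ _)) (-‿cong (sym ⟦ x ⟧-agree))) }
      ; 0-homo = -‿inverseʳ 0#
      ; 1-homo = refl
      }

    cancel : ∀ {w x y z} → w + z ≈ y + x → w - x ≈ y - z
    cancel {w} {x} {y} {z} p = +-cancelʳ z _ _ (begin
      (w - x) + z    ≈⟨ trans (+-assoc _ _ _) (trans (+-congˡ (+-comm _ _)) (sym (+-assoc _ _ _))) ⟩
      (w + z) - x    ≈⟨ +-congʳ p ⟩
      (y + x) - x    ≈⟨ trans (+-assoc _ _ _) (+-congˡ (-‿inverseʳ x)) ⟩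
      y + 0#         ≈⟨ +-congˡ (-‿inverseˡ z) ⟨
      y + (- z + z)  ≈⟨ +-assoc _ _ _ ⟨
      (y - z) + z    ∎)

    -- Differences are not normalised, so equality of the integers they denote is tested by cross
    -- addition.
    _≟_ : ∀ x y → Maybe (⟦ x ⟧₁ ≈ ⟦ y ⟧₁)
    x@(a , b) ≟ y@(c , d) with a ℕ.+ d ℕ.≟ c ℕ.+ b
    ... | yes p = just (trans ⟦ x ⟧-agree (trans
                    (cancel (trans (sym (×-homo-+ 1# a d)) (trans (×-congˡ p) (×-homo-+ 1# c b))))
                    (sym ⟦ y ⟧-agree)))
    ... | no _  = nothing

  open Algebra.Solver.Ring Differences ring′ morphism _≟_ public
    using (solve; _:=_; _:+_; _:*_; _:-_; :-_; _:^_; con; Polynomial)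

  ⟨1⟩ : ∀ {n} → Polynomial n
  ⟨1⟩ = con (1 , 0)

-- Computing with q-series modulo q^N

HasZeroPower : (R : CommutativeRing 0ℓ 0ℓ) → CommutativeRing.Carrier R → ℕ → Set
HasZeroPower R q N = q ^ N ≈ 0#
  where
  open CommutativeRing R
  open Algebra.Properties.Semiring.Exp semiring

module Nilpotent (R : CommutativeRing 0ℓ 0ℓ) (q : CommutativeRing.Carrier R)
                 (N : ℕ) (q^N≈0 : HasZeroPower R q N) where

  open CommutativeRing R
  open Algebra.Properties.CommutativeSemiring.Exp commutativeSemiring
  open Algebra.Properties.Semiring.Sum semiring
    using (sum; sum-cong-≋; *-distribˡ-sum; ∑-distrib-+)
  open Algebra.Properties.Ring ring using (-0#≈0#)
  open IntegerSolver R
  open Relation.Binary.Reasoning.Setoid setoid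

  0*≈0 : ∀ {x y} → x ≈ 0# → x * y ≈ 0#
  0*≈0 p = trans (*-congʳ p) (zeroˡ _)

  *0≈0 : ∀ {x y} → y ≈ 0# → x * y ≈ 0#
  *0≈0 p = trans (*-congˡ p) (zeroʳ _)

  -‿≈0 : ∀ {x} → x ≈ 0# → - x ≈ 0#
  -‿≈0 p = trans (-‿cong p) -0#≈0#

  1-0≈1 : ∀ {x} → x ≈ 0# → 1# - x ≈ 1#
  1-0≈1 p = trans (+-congˡ (-‿≈0 p)) (+-identityʳ 1#)

  q^≈0 : ∀ {k} → N ℕ.≤ k → q ^ k ≈ 0#
  q^≈0 {k} N≤k = begin
    q ^ k                      ≈⟨ ^-congʳ q (ℕ.m+[n∸m]≡n N≤k) ⟨
    q ^ (N ℕ.+ (k ℕ.∸ N))      ≈⟨ ^-homo-* q N (k ℕ.∸ N) ⟩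
    q ^ N * q ^ (k ℕ.∸ N)      ≈⟨ 0*≈0 q^N≈0 ⟩
    0#                         ∎

  q*^≈0 : ∀ v {k} → N ℕ.≤ k → (q * v) ^ k ≈ 0#
  q*^≈0 v {k} N≤k = trans (^-distrib-* q v k) (0*≈0 (q^≈0 N≤k))

  -- The difference `x - y` is fixed under multiplication by the nilpotent `q * v`, hence zero. This
  -- takes the place of inverting 1 - qv.
  1-q*-cancel : ∀ v {x y} → (1# - q * v) * x ≈ (1# - q * v) * y → x ≈ y
  1-q*-cancel v {x} {y} eq = begin
    x                ≈⟨ solve 2 (λ x y → x := (x :- y) :+ y) refl x y ⟩
    (x - y) + y      ≈⟨ +-congʳ (iterate N) ⟩
    u ^ N * (x - y) + y ≈⟨ +-congʳ (0*≈0 (q*^≈0 v ℕ.≤-refl)) ⟩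
    0# + y           ≈⟨ +-identityˡ y ⟩
    y                ∎
    where
    u = q * v
    fixed : x - y ≈ u * (x - y)
    fixed = begin
      x - y
        ≈⟨ solve 3 (λ u x y → x :- y := (((⟨1⟩ :- u) :* x) :- ((⟨1⟩ :- u) :* y)) :+ u :* (x :- y)) refl u x y ⟩
      (((1# - u) * x) - ((1# - u) * y)) + u * (x - y)
        ≈⟨ +-congʳ (trans (+-congʳ eq) (-‿inverseʳ _)) ⟩
      0# + u * (x - y)
        ≈⟨ +-identityˡ _ ⟩
      u * (x - y) ∎
    iterate : ∀ k → x - y ≈ u ^ k * (x - y)
    iterate zero    = sym (*-identityˡ _)
    iterate (suc k) = trans fixed (trans (*-congˡ (iterate k)) (sym (*-assoc _ _ _)))

  -- The q-Pochhammer symbol (u;Q)_n. Once `u * Q ^ n` vanishes all further factors are 1, so n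
  -- factors represent the infinite product (`poch-stable`).
  poch : Carrier → Carrier → ℕ → Carrier
  poch u Q zero    = 1#
  poch u Q (suc n) = (1# - u) * poch (u * Q) Q n

  poch-cong : ∀ {u v Q Q′} n → u ≈ v → Q ≈ Q′ → poch u Q n ≈ poch v Q′ n
  poch-cong zero    _   _   = refl
  poch-cong (suc n) u≈v Q≈ = *-cong (+-congˡ (-‿cong u≈v)) (poch-cong n (*-cong u≈v Q≈) Q≈)

  poch-last : ∀ u Q n → poch u Q (suc n) ≈ poch u Q n * (1# - u * Q ^ n)
  poch-last u Q zero    = solve 1 (λ u → (⟨1⟩ :- u) :* ⟨1⟩ := ⟨1⟩ :* (⟨1⟩ :- u :* ⟨1⟩)) refl u
  poch-last u Q (suc n) = begin
    (1# - u) * poch (u * Q) Q (suc n)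
      ≈⟨ *-congˡ (poch-last (u * Q) Q n) ⟩
    (1# - u) * (poch (u * Q) Q n * (1# - u * Q * Q ^ n))
      ≈⟨ solve 4 (λ u Q X p → (⟨1⟩ :- u) :* (p :* (⟨1⟩ :- u :* Q :* X))
                           := (⟨1⟩ :- u) :* p :* (⟨1⟩ :- u :* (Q :* X))) refl u Q (Q ^ n) (poch (u * Q) Q n) ⟩
    poch u Q (suc n) * (1# - u * Q ^ suc n) ∎

  poch-stable : ∀ u Q n j → u * Q ^ n ≈ 0# → poch u Q (j ℕ.+ n) ≈ poch u Q n
  poch-stable u Q n zero    _  = refl
  poch-stable u Q n (suc j) eq = begin
    poch u Q (suc (j ℕ.+ n))                       ≈⟨ poch-last u Q (j ℕ.+ n) ⟩
    poch u Q (j ℕ.+ n) * (1# - u * Q ^ (j ℕ.+ n))  ≈⟨ *-congˡ (1-0≈1 vanish) ⟩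
    poch u Q (j ℕ.+ n) * 1#                        ≈⟨ *-identityʳ _ ⟩
    poch u Q (j ℕ.+ n)                             ≈⟨ poch-stable u Q n j eq ⟩
    poch u Q n                                     ∎
    where
    vanish : u * Q ^ (j ℕ.+ n) ≈ 0#
    vanish = begin
      u * Q ^ (j ℕ.+ n)    ≈⟨ *-congˡ (^-homo-* Q j n) ⟩
      u * (Q ^ j * Q ^ n)  ≈⟨ solve 3 (λ u x y → u :* (x :* y) := (u :* y) :* x) refl u (Q ^ j) (Q ^ n) ⟩
      u * Q ^ n * Q ^ j    ≈⟨ 0*≈0 eq ⟩
      0#                   ∎

  poch-≈1 : ∀ {u} Q n → u ≈ 0# → poch u Q n ≈ 1#
  poch-≈1 Q zero    _  = refl
  poch-≈1 Q (suc n) eq = trans (*-cong (1-0≈1 eq) (poch-≈1 Q n (0*≈0 eq))) (*-identityˡ 1#)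

  poch-cancel : ∀ v Q n {x y} → poch (q * v) Q n * x ≈ poch (q * v) Q n * y → x ≈ y
  poch-cancel v Q zero    eq = trans (sym (*-identityˡ _)) (trans eq (*-identityˡ _))
  poch-cancel v Q (suc n) {x} {y} eq = poch-cancel (v * Q) Q n (begin
    poch (q * (v * Q)) Q n * x  ≈⟨ *-congʳ (poch-cong n (*-assoc q v Q) refl) ⟨
    poch (q * v * Q) Q n * x    ≈⟨ 1-q*-cancel v (trans (sym (*-assoc _ _ _)) (trans eq (*-assoc _ _ _))) ⟩
    poch (q * v * Q) Q n * y    ≈⟨ *-congʳ (poch-cong n (*-assoc q v Q) refl) ⟩
    poch (q * (v * Q)) Q n * y  ∎)

  Σ : ℕ → (ℕ → Carrier) → Carrier
  Σ n f = sum {n} (f ∘ toℕ)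

  Σ-cong : ∀ n {f g} → (∀ k → f k ≈ g k) → Σ n f ≈ Σ n g
  Σ-cong n eq = sum-cong-≋ {n} (eq ∘ toℕ)

  Σ-*ˡ : ∀ n x f → x * Σ n f ≈ Σ n (λ k → x * f k)
  Σ-*ˡ n x f = *-distribˡ-sum {n} x (f ∘ toℕ)

  Σ-+ : ∀ n f g → Σ n (λ k → f k + g k) ≈ Σ n f + Σ n g
  Σ-+ n f g = ∑-distrib-+ {n} (f ∘ toℕ) (g ∘ toℕ)

  Σ-≈0 : ∀ n {f} → (∀ k → f k ≈ 0#) → Σ n f ≈ 0#
  Σ-≈0 zero    _  = refl
  Σ-≈0 (suc n) eq = trans (+-cong (eq 0) (Σ-≈0 n (eq ∘ suc))) (+-identityˡ 0#)

  Σ-last : ∀ n f → Σ (suc n) f ≈ Σ n f + f n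
  Σ-last zero    f = +-comm _ _
  Σ-last (suc n) f = trans (+-congˡ (Σ-last n (f ∘ suc))) (sym (+-assoc _ _ _))

  Σ-telescope : ∀ n (a b : ℕ → Carrier) → Σ n (λ k → a k + (b (suc k) - b k)) ≈ Σ n a + (b n - b 0)
  Σ-telescope zero    a b = sym (trans (+-identityˡ _) (-‿inverseʳ (b 0)))
  Σ-telescope (suc n) a b = trans (+-congˡ (Σ-telescope n (a ∘ suc) (b ∘ suc)))
    (solve 5 (λ a s x y z → (a :+ (x :- y)) :+ (s :+ (z :- x)) := (a :+ s) :+ (z :- y)) refl
      (a 0) (Σ n (a ∘ suc)) (b 1) (b 0) (b (suc n)))

  -- The common shape of the q-series proofs: the summands agree up to a difference of consecutive
  -- `b`, which is a polynomial identity for the solver. In the uses below `b 0` vanishes through a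
  -- factor 1 - q^0 or 1 - Q^0, and `b n` through truncation.
  Σ-telescope′ : ∀ n (a b : ℕ → Carrier) → b 0 ≈ 0# → b n ≈ 0# → Σ n (λ k → a k + (b (suc k) - b k)) ≈ Σ n a
  Σ-telescope′ n a b b0 bn = trans (Σ-telescope n a b)
    (trans (+-congˡ (trans (+-cong bn (-‿cong b0)) (-‿inverseʳ 0#))) (+-identityʳ _))

-- Andrews' series for k = 3

module Gordon (R : CommutativeRing 0ℓ 0ℓ) (q : CommutativeRing.Carrier R)
                 (N : ℕ) (q^N≈0 : HasZeroPower R q N) where
  open Nilpotent R q N q^N≈0
  open CommutativeRing R
  open Algebra.Properties.CommutativeSemiring.Exp commutativeSemiring
  open IntegerSolver R
  open Relation.Binary.Reasoning.Setoid setoid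

  record Solution (α β F H : ℕ → Carrier) : Set where
    field
      F-step : ∀ m → F m ≈ H m + α m * F (suc m)
      H-step : ∀ m → H m ≈ F (suc m) + β m * H (suc (suc m))
  open Solution

  -- The system determines F and H backwards from their values at m ≥ N.
  solution-unique : ∀ {α β F H F′ H′} → Solution α β F H → Solution α β F′ H′ →
                    (∀ m → N ℕ.≤ m → F m ≈ F′ m) → (∀ m → N ℕ.≤ m → H m ≈ H′ m) →
                    ∀ m → F m ≈ F′ m
  solution-unique {α} {β} {F} {H} {F′} {H′} s s′ F-large H-large m = proj₁ (go N m (ℕ.m≤m+n N m))
    where
    go : ∀ k m → N ℕ.≤ k ℕ.+ m → F m ≈ F′ m × H m ≈ H′ m
    go zero    m N≤ = F-large m N≤ , H-large m N≤
    go (suc k) m N≤ = F≈ , H≈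
      where
      N≤₁ : N ℕ.≤ k ℕ.+ suc m
      N≤₁ = ℕ.≤-trans N≤ (ℕ.≤-reflexive (≡.sym (ℕ.+-suc k m)))
      N≤₂ : N ℕ.≤ k ℕ.+ suc (suc m)
      N≤₂ = ℕ.≤-trans N≤₁ (ℕ.+-monoʳ-≤ k (ℕ.n≤1+n (suc m)))
      H≈ : H m ≈ H′ m
      H≈ = trans (H-step s m) (trans
        (+-cong (proj₁ (go k (suc m) N≤₁)) (*-congˡ (proj₂ (go k (suc (suc m)) N≤₂))))
        (sym (H-step s′ m)))
      F≈ : F m ≈ F′ m
      F≈ = trans (F-step s m) (trans
        (+-cong H≈ (*-congˡ (proj₁ (go k (suc m) N≤₁))))
        (sym (F-step s′ m)))

  solution-*ˡ : ∀ x {α β F H} → Solution α β F H → Solution α β (λ m → x * F m) (λ m → x * H m)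
  solution-*ˡ x {α} {β} {F} {H} s = record
    { F-step = λ m → trans (*-congˡ (F-step s m)) (lemma (H m) (α m) (F (suc m)))
    ; H-step = λ m → trans (*-congˡ (H-step s m)) (lemma (F (suc m)) (β m) (H (suc (suc m))))
    }
    where
    lemma : ∀ y a z → x * (y + a * z) ≈ x * y + a * (x * z)
    lemma = solve 4 (λ x y a z → x :* (y :+ a :* z) := x :* y :+ a :* (x :* z)) refl x

  -- (-1)ⁿ q^(3mn + 7n(n−1)/2)
  c : ℕ → ℕ → Carrier
  c m zero    = 1#
  c m (suc n) = - ((q ^ m) ^ 3 * (q ^ n) ^ 7 * c m n)

  c-suc : ∀ m n → c (suc m) n ≈ (q ^ n) ^ 3 * c m n
  c-suc m zero    = solve 0 (⟨1⟩ := ⟨1⟩ :^ 3 :* ⟨1⟩) refl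
  c-suc m (suc n) = trans (-‿cong (*-congˡ (c-suc m n)))
    (solve 4 (λ q y x c → :- ((q :* y) :^ 3 :* x :^ 7 :* (x :^ 3 :* c))
                       := (q :* x) :^ 3 :* (:- (y :^ 3 :* x :^ 7 :* c))) refl q (q ^ m) (q ^ n) (c m n))

  -- The denominators (q;q)_n and (q^(m+n+1);q)∞ of Andrews' series, cleared by (q;q)∞, leave the
  -- polynomial (q^(n+1);q)_m.
  p : ℕ → ℕ → Carrier
  p m n = poch (q ^ suc n) q m

  p-last : ∀ m n → p (suc m) n ≈ (1# - q * q ^ n * q ^ m) * p m n
  p-last m n = trans (poch-last (q ^ suc n) q m) (*-comm _ _)

  p-first : ∀ m n → (1# - q * q ^ n) * p m (suc n) ≈ p (suc m) n
  p-first m n = *-congˡ (poch-cong m (*-comm _ _) refl)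

  -- Σₙ term i (7 − i) m n is Andrews’ J_{3,i}(q^m), multiplied by (q;q)∞.
  term : ℕ → ℕ → ℕ → ℕ → Carrier
  term i j m n = c m n * (q ^ n) ^ j * (1# - (q ^ m * (q ^ n) ^ 2 * q) ^ i) * p m n

  -- The telescoping certificate. In the difference of the terms for i and i - 1 one piece contains
  -- 1 - q^n and is minus this carry. Moved to n + 1, the factor 1 - q^(n+1) turns `p m (suc n)`
  -- into `p (suc m) n` (`p-first`), which supplies the subtracted half of a term at m + 1.
  carry : ℕ → ℕ → ℕ → Carrier
  carry j m n = - (c m n * (q ^ n) ^ j * (1# - q ^ n) * p m n)

  carry-suc : ∀ j m n → carry j m (suc n) ≈
    (q ^ m) ^ 3 * (q ^ n) ^ 7 * c m n * (q * q ^ n) ^ j * ((1# - q * q ^ n * q ^ m) * p m n)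
  carry-suc j m n = begin
    - (- (b * c m n) * d * (1# - q * q ^ n) * p m (suc n))
      ≈⟨ solve 5 (λ b c d e p → :- ((:- (b :* c)) :* d :* e :* p) := b :* c :* d :* (e :* p)) refl
           b (c m n) d (1# - q * q ^ n) (p m (suc n)) ⟩
    b * c m n * d * ((1# - q * q ^ n) * p m (suc n))
      ≈⟨ *-congˡ (trans (p-first m n) (p-last m n)) ⟩
    b * c m n * d * ((1# - q * q ^ n * q ^ m) * p m n) ∎
    where
    b = (q ^ m) ^ 3 * (q ^ n) ^ 7
    d = (q * q ^ n) ^ j

  term-suc : ∀ i j m n → term i j (suc m) n ≈
    (q ^ n) ^ 3 * c m n * (q ^ n) ^ j * (1# - (q * q ^ m * (q ^ n) ^ 2 * q) ^ i)
      * ((1# - q * q ^ n * q ^ m) * p m n)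
  term-suc i j m n = *-cong (*-congʳ (*-congʳ (c-suc m n))) (p-last m n)

  -- This and the next two are the cases i = 1, 2, 3 of J_{3,i}(x) - J_{3,i-1}(x) = (xq)^(i-1)
  -- J_{3,4-i}(xq) at x = q^m, with J_{3,0} = 0, read term by term. The factor 1 - q^(m+n+1) needed
  -- to raise m in `p` appears in the numerator by itself.
  term₁ : ∀ m n → term 1 6 m n ≈ term 3 4 (suc m) n + (carry 6 m (suc n) - carry 6 m n)
  term₁ m n = trans
    (solve 5 (λ q x y c p →
        c :* x :^ 6 :* (⟨1⟩ :- (y :* x :^ 2 :* q) :^ 1) :* p
        := x :^ 3 :* c :* x :^ 4 :* (⟨1⟩ :- (q :* y :* x :^ 2 :* q) :^ 3) :* ((⟨1⟩ :- q :* x :* y) :* p)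
           :+ (y :^ 3 :* x :^ 7 :* c :* (q :* x) :^ 6 :* ((⟨1⟩ :- q :* x :* y) :* p)
               :- :- (c :* x :^ 6 :* (⟨1⟩ :- x) :* p)))
      refl q (q ^ n) (q ^ m) (c m n) (p m n))
    (sym (+-cong (term-suc 3 4 m n) (+-congʳ (carry-suc 6 m n))))

  term₂ : ∀ m n → term 2 5 m n ≈
    (term 1 6 m n + q ^ suc m * term 2 5 (suc m) n) + (carry 5 m (suc n) - carry 5 m n)
  term₂ m n = trans
    (solve 5 (λ q x y c p →
        c :* x :^ 5 :* (⟨1⟩ :- (y :* x :^ 2 :* q) :^ 2) :* p
        := (c :* x :^ 6 :* (⟨1⟩ :- (y :* x :^ 2 :* q) :^ 1) :* p
           :+ q :* y :* (x :^ 3 :* c :* x :^ 5 :* (⟨1⟩ :- (q :* y :* x :^ 2 :* q) :^ 2) :* ((⟨1⟩ :- q :* x :* y) :* p)))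
           :+ (y :^ 3 :* x :^ 7 :* c :* (q :* x) :^ 5 :* ((⟨1⟩ :- q :* x :* y) :* p)
               :- :- (c :* x :^ 5 :* (⟨1⟩ :- x) :* p)))
      refl q (q ^ n) (q ^ m) (c m n) (p m n))
    (sym (+-cong (+-congˡ (*-congˡ (term-suc 2 5 m n))) (+-congʳ (carry-suc 5 m n))))

  term₃ : ∀ m n → term 3 4 m n ≈
    (term 2 5 m n + (q ^ suc m) ^ 2 * term 1 6 (suc m) n) + (carry 4 m (suc n) - carry 4 m n)
  term₃ m n = trans
    (solve 5 (λ q x y c p →
        c :* x :^ 4 :* (⟨1⟩ :- (y :* x :^ 2 :* q) :^ 3) :* p
        := (c :* x :^ 5 :* (⟨1⟩ :- (y :* x :^ 2 :* q) :^ 2) :* p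
           :+ (q :* y) :^ 2 :* (x :^ 3 :* c :* x :^ 6 :* (⟨1⟩ :- (q :* y :* x :^ 2 :* q) :^ 1) :* ((⟨1⟩ :- q :* x :* y) :* p)))
           :+ (y :^ 3 :* x :^ 7 :* c :* (q :* x) :^ 4 :* ((⟨1⟩ :- q :* x :* y) :* p)
               :- :- (c :* x :^ 4 :* (⟨1⟩ :- x) :* p)))
      refl q (q ^ n) (q ^ m) (c m n) (p m n))
    (sym (+-cong (+-congˡ (*-congˡ (term-suc 1 6 m n))) (+-congʳ (carry-suc 4 m n))))

  S : ℕ → ℕ → ℕ → ℕ → Carrier
  S K i j m = Σ K (term i j m)

  module _ (K : ℕ) (N≤K : N ℕ.≤ K) where

    carry-first : ∀ j m → carry j m 0 ≈ 0#
    carry-first j m = -‿≈0 (0*≈0 (*0≈0 (-‿inverseʳ 1#)))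

    carry-end : ∀ j m → carry (suc j) m K ≈ 0#
    carry-end j m = -‿≈0 (0*≈0 (0*≈0 (*0≈0 (0*≈0 (q^≈0 N≤K)))))

    S₁ : ∀ m → S K 1 6 m ≈ S K 3 4 (suc m)
    S₁ m = trans (Σ-cong K (term₁ m))
      (Σ-telescope′ K (term 3 4 (suc m)) (carry 6 m) (carry-first 6 m) (carry-end 5 m))

    Σ-split : ∀ x f g → Σ K (λ n → f n + x * g n) ≈ Σ K f + x * Σ K g
    Σ-split x f g = trans (Σ-+ K f (λ n → x * g n)) (+-congˡ (sym (Σ-*ˡ K x g)))

    S₂ : ∀ m → S K 2 5 m ≈ S K 1 6 m + q ^ suc m * S K 2 5 (suc m)
    S₂ m = trans (Σ-cong K (term₂ m)) (trans
      (Σ-telescope′ K (λ n → term 1 6 m n + q ^ suc m * term 2 5 (suc m) n) (carry 5 m)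
        (carry-first 5 m) (carry-end 4 m))
      (Σ-split (q ^ suc m) (term 1 6 m) (term 2 5 (suc m))))

    S₃ : ∀ m → S K 3 4 m ≈ S K 2 5 m + (q ^ suc m) ^ 2 * S K 1 6 (suc m)
    S₃ m = trans (Σ-cong K (term₃ m)) (trans
      (Σ-telescope′ K (λ n → term 2 5 m n + (q ^ suc m) ^ 2 * term 1 6 (suc m) n) (carry 4 m)
        (carry-first 4 m) (carry-end 3 m))
      (Σ-split ((q ^ suc m) ^ 2) (term 2 5 m) (term 1 6 (suc m))))

    S-solution : Solution (λ m → q ^ suc m) (λ m → (q ^ suc (suc m)) ^ 2) (S K 2 5) (S K 1 6)
    S-solution = record { F-step = S₂ ; H-step = λ m → trans (S₁ m) (S₃ (suc m)) }

  ⟨q⟩∞ : Carrier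
  ⟨q⟩∞ = poch (q ^ 1) q N

  -- For `m ≥ N` the factor `(q ^ m) ^ 3` in `c` kills every term except n = 0, which leaves
  -- (q;q)_m. This boundary value does not depend on i, so both components of the system are
  -- normalised by the same constant.
  S-large : ∀ K i j m → N ℕ.≤ m → S (suc K) (suc i) j m ≈ ⟨q⟩∞
  S-large K i j m N≤m = begin
    term (suc i) j m 0 + Σ K (term (suc i) j m ∘ suc)
      ≈⟨ +-cong first (Σ-≈0 K rest) ⟩
    p m 0 + 0#                           ≈⟨ +-identityʳ _ ⟩
    poch (q ^ 1) q m                     ≈⟨ reflexive (≡.cong (poch (q ^ 1) q) (ℕ.m∸n+n≡m N≤m)) ⟨
    poch (q ^ 1) q (m ℕ.∸ N ℕ.+ N)       ≈⟨ poch-stable (q ^ 1) q N (m ℕ.∸ N) (*0≈0 q^N≈0) ⟩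
    ⟨q⟩∞                                 ∎
    where
    y≈0 : q ^ m ≈ 0#
    y≈0 = q^≈0 N≤m
    one : ∀ j → 1# ^ j ≈ 1#
    one zero    = refl
    one (suc j) = trans (*-identityˡ _) (one j)
    first : term (suc i) j m 0 ≈ p m 0
    first = trans (*-congʳ (*-cong (trans (*-identityˡ _) (one j)) (1-0≈1 (0*≈0 (0*≈0 (0*≈0 y≈0))))))
                  (trans (*-congʳ (*-identityˡ 1#)) (*-identityˡ _))
    rest : ∀ n → term (suc i) j m (suc n) ≈ 0#
    rest n = 0*≈0 (0*≈0 (0*≈0 (-‿≈0 (0*≈0 (0*≈0 (0*≈0 y≈0))))))

-- Jacobi's triple product

module TripleProduct (R : CommutativeRing 0ℓ 0ℓ) (q : CommutativeRing.Carrier R)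
                 (N : ℕ) (q^N≈0 : HasZeroPower R q N)
                 (z′ w′ : CommutativeRing.Carrier R) where
  open Nilpotent R q N q^N≈0
  open CommutativeRing R
  open Algebra.Properties.CommutativeSemiring.Exp commutativeSemiring
  open IntegerSolver R
  open Relation.Binary.Reasoning.Setoid setoid

  z w Q : Carrier
  z = q * z′
  w = q * w′
  Q = z * w

  Q^≈0 : ∀ {k} → N ℕ.≤ k → Q ^ k ≈ 0#
  Q^≈0 {k} N≤k = trans (^-congˡ k (*-assoc q z′ w)) (q*^≈0 (z′ * w) N≤k)

  -- (-u)^k Q^(k(k-1)/2), the numerator in Euler's expansion of (u;Q)∞.
  e : Carrier → ℕ → Carrier
  e u zero    = 1#
  e u (suc k) = - (u * Q ^ k) * e u k

  e-cong : ∀ {u v} k → u ≈ v → e u k ≈ e v k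
  e-cong zero    _   = refl
  e-cong (suc k) u≈v = *-cong (-‿cong (*-congʳ u≈v)) (e-cong k u≈v)

  e-scale : ∀ v u k → e (v * u) k ≈ v ^ k * e u k
  e-scale v u zero    = sym (*-identityˡ 1#)
  e-scale v u (suc k) = trans (*-congˡ (e-scale v u k))
    (solve 5 (λ v u X V e → :- (v :* u :* X) :* (V :* e) := v :* V :* (:- (u :* X) :* e)) refl
      v u (Q ^ k) (v ^ k) (e u k))

  e-≈0 : ∀ v {k} → N ℕ.≤ k → e (q * v) k ≈ 0#
  e-≈0 v {k} N≤k = trans (e-scale q v k) (0*≈0 (q^≈0 N≤k))

  -- (Q;Q)∞ / (Q;Q)ₖ
  t : ℕ → Carrier
  t k = poch (Q ^ suc k) Q N

  t-step : ∀ k → t k ≈ (1# - Q * Q ^ k) * t (suc k)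
  t-step k = begin
    poch (Q ^ suc k) Q N                          ≈⟨ poch-stable (Q ^ suc k) Q N 1 (*0≈0 (Q^≈0 ℕ.≤-refl)) ⟨
    (1# - Q ^ suc k) * poch (Q ^ suc k * Q) Q N   ≈⟨ *-congˡ (poch-cong N (*-comm _ _) refl) ⟩
    (1# - Q ^ suc k) * t (suc k)                  ∎

  module _ (j : ℕ) (N≤j : N ℕ.≤ j) where

    f : Carrier → Carrier
    f u = Σ (suc j) (λ k → e u k * t k)

    -- `f u` is Euler's series Σ (-u)^k Q^(k(k-1)/2) / (Q;Q)_k multiplied by (Q;Q)∞, and this is the
    -- functional equation of (u;Q)∞. That `u` is a multiple of `q` makes the boundary term at the
    -- upper end vanish.
    f-step : ∀ v u → u ≈ q * v → f u ≈ (1# - u) * f (u * Q)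
    f-step v u u≈ = sym (begin
      (1# - u) * f (u * Q)
        ≈⟨ Σ-*ˡ (suc j) (1# - u) (λ k → e (u * Q) k * t k) ⟩
      Σ (suc j) (λ k → (1# - u) * (e (u * Q) k * t k))
        ≈⟨ Σ-cong (suc j) summand ⟩
      Σ (suc j) (λ k → a k + (b (suc k) - b k))
        ≈⟨ Σ-telescope′ (suc j) a b (0*≈0 (-‿inverseʳ 1#))
             (*0≈0 (0*≈0 (trans (e-cong (suc j) u≈) (e-≈0 v (ℕ.m≤n⇒m≤1+n N≤j))))) ⟩
      f u ∎)
      where
      a b : ℕ → Carrier
      a k = e u k * t k
      b k = (1# - Q ^ k) * a k
      summand : ∀ k → (1# - u) * (e (u * Q) k * t k) ≈ a k + (b (suc k) - b k)
      summand k = begin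
        (1# - u) * (e (u * Q) k * t k)
          ≈⟨ *-congˡ (*-cong (trans (e-cong k (*-comm u Q)) (e-scale Q u k)) (t-step k)) ⟩
        (1# - u) * (X * E * ((1# - Q * X) * T))
          ≈⟨ solve 5 (λ u Q X E T →
               (⟨1⟩ :- u) :* (X :* E :* ((⟨1⟩ :- Q :* X) :* T))
               := E :* ((⟨1⟩ :- Q :* X) :* T) :+ ((⟨1⟩ :- Q :* X) :* (:- (u :* X) :* E :* T)
                    :- (⟨1⟩ :- X) :* (E :* ((⟨1⟩ :- Q :* X) :* T)))) refl u Q X E T ⟩
        E * ((1# - Q * X) * T) + (b (suc k) - (1# - X) * (E * ((1# - Q * X) * T)))
          ≈⟨ +-cong (*-congˡ (t-step k)) (+-congˡ (-‿cong (*-congˡ (*-congˡ (t-step k))))) ⟨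
        a k + (b (suc k) - b k) ∎
        where
        X = Q ^ k
        E = e u k
        T = t (suc k)

    f-cong : ∀ {u v} → u ≈ v → f u ≈ f v
    f-cong u≈v = Σ-cong (suc j) (λ k → *-congʳ {t k} (e-cong k u≈v))

    f-steps : ∀ n v u → u ≈ q * v → f u ≈ poch u Q n * f (u * Q ^ n)
    f-steps zero    v u u≈ = sym (trans (*-identityˡ _) (f-cong (*-identityʳ u)))
    f-steps (suc n) v u u≈ = begin
      f u                                          ≈⟨ f-step v u u≈ ⟩
      (1# - u) * f (u * Q)                         ≈⟨ *-congˡ (f-steps n (v * Q) (u * Q) (trans (*-congʳ u≈) (*-assoc q v Q))) ⟩
      (1# - u) * (poch (u * Q) Q n * f (u * Q * Q ^ n))
        ≈⟨ *-assoc _ _ _ ⟨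
      poch u Q (suc n) * f (u * Q * Q ^ n)
        ≈⟨ *-congˡ (f-cong (*-assoc u Q (Q ^ n))) ⟩
      poch u Q (suc n) * f (u * Q ^ suc n)         ∎

    f-≈0 : ∀ {u} → u ≈ 0# → f u ≈ t 0
    f-≈0 {u} u≈0 = trans (+-cong (*-identityˡ _) (Σ-≈0 j {λ k → e u (suc k) * t (suc k)}
      (λ k → 0*≈0 (0*≈0 (-‿≈0 (0*≈0 u≈0)))))) (+-identityʳ _)

    euler : ∀ v → f (q * v) ≈ poch (q * v) Q N * t 0
    euler v = trans (f-steps N v (q * v) refl) (*-congˡ (f-≈0 (*0≈0 (Q^≈0 ℕ.≤-refl))))

  -- E m k is the coefficient (-z)^j Q^(j(j−1)/2) with j = k − m, where z⁻¹ is represented by w / Q.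
  E : ℕ → ℕ → Carrier
  E zero    k       = e z k
  E (suc m) zero    = e w (suc m)
  E (suc m) (suc k) = E m k

  E-diagonal : ∀ m j → E m (m ℕ.+ j) ≡ e z j
  E-diagonal zero    j = ≡.refl
  E-diagonal (suc m) j = E-diagonal m j

  E-low : ∀ m k → k ℕ.+ N ℕ.< m → E m k ≈ 0#
  E-low (suc m) zero    N<m         = e-≈0 w′ (ℕ.<⇒≤ N<m)
  E-low (suc m) (suc k) (s≤s k+N<m) = E-low m k k+N<m

  -- Raising the index from j - 1 to j multiplies a coefficient by -z Q^(j-1). With j = k - m the
  -- exponent may be negative; the factor w Q^m repairs this because z w = Q.
  E-step : ∀ m k → - (w * Q ^ m) * E m k ≈ Q ^ k * E (suc m) k
  E-step zero    zero    = sym (*-identityˡ _)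
  E-step (suc m) zero    = sym (*-identityˡ _)
  E-step zero    (suc k) = solve 4 (λ z w X e → :- (w :* ⟨1⟩) :* (:- (z :* X) :* e) := z :* w :* X :* e) refl
                             z w (Q ^ k) (e z k)
  E-step (suc m) (suc k) = begin
    - (w * (Q * Q ^ m)) * E m k
      ≈⟨ solve 4 (λ w Q X e → :- (w :* (Q :* X)) :* e := Q :* (:- (w :* X) :* e)) refl w Q (Q ^ m) (E m k) ⟩
    Q * (- (w * Q ^ m) * E m k)    ≈⟨ *-congˡ (E-step m k) ⟩
    Q * (Q ^ k * E (suc m) k)      ≈⟨ *-assoc _ _ _ ⟨
    Q ^ suc k * E (suc m) k        ∎

  Σ-E : ∀ m l → Σ (m ℕ.+ l) (E m) ≈ Σ m (e w ∘ suc) + Σ l (e z)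
  Σ-E zero    l = sym (+-identityˡ _)
  Σ-E (suc m) l = begin
    e w (suc m) + Σ (m ℕ.+ l) (E m)               ≈⟨ +-congˡ (Σ-E m l) ⟩
    e w (suc m) + (Σ m (e w ∘ suc) + Σ l (e z))   ≈⟨ +-assoc _ _ _ ⟨
    e w (suc m) + Σ m (e w ∘ suc) + Σ l (e z)     ≈⟨ +-congʳ (trans (+-comm _ _) (sym (Σ-last m (e w ∘ suc)))) ⟩
    Σ (suc m) (e w ∘ suc) + Σ l (e z)             ∎

  module _ (j : ℕ) (N≤j : N ℕ.≤ j) where

    -- Euler's expansion of (z Q^(-m);Q)∞, divided by the monomial (-z)^m Q^(-m(m+1)/2) that splits
    -- off from its first m factors. What remains of those factors is (w;Q)_m, so `W m` interpolates
    -- between Euler's formula at m = 0 and the bilateral series.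
    W : ℕ → Carrier
    W m = Σ (m ℕ.+ suc j) (λ k → E m k * t k)

    W-step : ∀ m → (1# - w * Q ^ m) * W m ≈ W (suc m)
    W-step m = begin
      (1# - w * Q ^ m) * W m
        ≈⟨ Σ-*ˡ L (1# - w * Q ^ m) (λ k → E m k * t k) ⟩
      Σ L (λ k → (1# - w * Q ^ m) * (E m k * t k))
        ≈⟨ Σ-cong L summand ⟩
      Σ L (λ k → a k + (b (suc k) - b k))
        ≈⟨ Σ-telescope′ L a b (0*≈0 (-‿inverseʳ 1#)) (*0≈0 a-end) ⟩
      Σ L a
        -- `W (suc m)` has one summand more than `W m`; it contains `e z j`, which is zero because
        -- `j ≥ N`.
        ≈⟨ trans (+-congˡ a-end) (+-identityʳ _) ⟨
      Σ L a + a L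
        ≈⟨ Σ-last L a ⟨
      W (suc m) ∎
      where
      L = m ℕ.+ suc j
      a b : ℕ → Carrier
      a k = E (suc m) k * t k
      b k = (1# - Q ^ k) * a k
      a-end : a L ≈ 0#
      a-end = 0*≈0 (begin
        E (suc m) (m ℕ.+ suc j)   ≡⟨ ≡.cong (E (suc m)) (ℕ.+-suc m j) ⟩
        E m (m ℕ.+ j)             ≡⟨ E-diagonal m j ⟩
        e z j                     ≈⟨ e-≈0 z′ N≤j ⟩
        0#                        ∎)
      summand : ∀ k → (1# - w * Q ^ m) * (E m k * t k) ≈ a k + (b (suc k) - b k)
      summand k = begin
        (1# - w * Q ^ m) * (D * t k)
          ≈⟨ solve 3 (λ v D t → (⟨1⟩ :- v) :* (D :* t) := D :* t :+ (:- v :* D) :* t) refl (w * Q ^ m) D (t k) ⟩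
        D * t k + (- (w * Q ^ m) * D) * t k
          ≈⟨ +-cong (*-congˡ (t-step k)) (*-cong (E-step m k) (t-step k)) ⟩
        D * ((1# - Q * X) * T) + X * G * ((1# - Q * X) * T)
          ≈⟨ solve 5 (λ D G Q X T →
               D :* ((⟨1⟩ :- Q :* X) :* T) :+ X :* G :* ((⟨1⟩ :- Q :* X) :* T)
               := G :* ((⟨1⟩ :- Q :* X) :* T) :+ ((⟨1⟩ :- Q :* X) :* (D :* T)
                    :- (⟨1⟩ :- X) :* (G :* ((⟨1⟩ :- Q :* X) :* T)))) refl D G Q X T ⟩
        G * ((1# - Q * X) * T) + (b (suc k) - (1# - X) * (G * ((1# - Q * X) * T)))
          ≈⟨ +-cong (*-congˡ (t-step k)) (+-congˡ (-‿cong (*-congˡ (*-congˡ (t-step k))))) ⟨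
        a k + (b (suc k) - b k) ∎
        where
        D = E m k
        G = E (suc m) k
        X = Q ^ k
        T = t (suc k)

    W-product : ∀ m → poch w Q m * (poch z Q N * t 0) ≈ W m
    W-product zero    = trans (*-identityˡ _) (sym (euler j N≤j z′))
    W-product (suc m) = begin
      poch w Q (suc m) * x                ≈⟨ *-congʳ (trans (poch-last w Q m) (*-comm _ _)) ⟩
      (1# - w * Q ^ m) * poch w Q m * x   ≈⟨ trans (*-assoc _ _ _) (*-congˡ (W-product m)) ⟩
      (1# - w * Q ^ m) * W m              ≈⟨ W-step m ⟩
      W (suc m)                           ∎
      where x = poch z Q N * t 0

    -- For m ≥ 2N, either the coefficient E m k or the tail of t k beyond 1 vanishes.
    W-limit : W (N ℕ.+ N) ≈ Σ (N ℕ.+ N) (e w ∘ suc) + Σ (suc j) (e z)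
    W-limit = trans (Σ-cong (N ℕ.+ N ℕ.+ suc j) drop) (Σ-E (N ℕ.+ N) (suc j))
      where
      drop : ∀ k → E (N ℕ.+ N) k * t k ≈ E (N ℕ.+ N) k
      drop k with N ℕ.≤? k
      ... | yes N≤k = trans (*-congˡ (poch-≈1 Q N (Q^≈0 (ℕ.m≤n⇒m≤1+n N≤k)))) (*-identityʳ _)
      ... | no N≰k  = trans (0*≈0 low) (sym low)
        where low = E-low (N ℕ.+ N) k (ℕ.+-monoˡ-< N (ℕ.≰⇒> N≰k))

    tripleProduct : poch w Q N * (poch z Q N * poch (Q ^ 1) Q N) ≈
                    Σ (N ℕ.+ N) (e w ∘ suc) + Σ (suc j) (e z)
    tripleProduct = trans (*-congʳ (sym (poch-stable w Q N N (*0≈0 (Q^≈0 ℕ.≤-refl)))))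
                          (trans (W-product (N ℕ.+ N)) W-limit)

-- Matching series, products and recurrences

module Identity (R : CommutativeRing 0ℓ 0ℓ) (q : CommutativeRing.Carrier R)
                 (N : ℕ) (q^N≈0 : HasZeroPower R q N) where
  open CommutativeRing R
  open Algebra.Properties.CommutativeSemiring.Exp commutativeSemiring
  open IntegerSolver R
  open Relation.Binary.Reasoning.Setoid setoid
  open Nilpotent R q N q^N≈0
  open Gordon R q N q^N≈0
  -- This makes z = q^2, w = q^5 and Q = q^7, matching the residues 2, 5 and 0 modulo 7 that A
  -- forbids.
  open TripleProduct R q N q^N≈0 q (q ^ 4)

  Q^n≈ : ∀ n → Q ^ n ≈ (q ^ n) ^ 7
  Q^n≈ n = begin
    Q ^ n          ≈⟨ ^-congˡ n (solve 1 (λ q → (q :* q) :* (q :* q :^ 4) := q :^ 7) refl q) ⟩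
    (q ^ 7) ^ n    ≈⟨ ^-assocʳ q 7 n ⟩
    q ^ (7 ℕ.* n)  ≈⟨ ^-congʳ q (ℕ.*-comm 7 n) ⟩
    q ^ (n ℕ.* 7)  ≈⟨ ^-assocʳ q n 7 ⟨
    (q ^ n) ^ 7    ∎

  productSide : Carrier
  productSide = poch w Q N * (poch z Q N * poch (Q ^ 1) Q N)

  e-w : ∀ n → e w n ≈ c 0 n * (q ^ n) ^ 5
  e-w zero    = solve 0 (⟨1⟩ := ⟨1⟩ :* ⟨1⟩ :^ 5) refl
  e-w (suc n) = trans (*-cong (-‿cong (*-congˡ (Q^n≈ n))) (e-w n))
    (solve 3 (λ q x c → :- (q :* q :^ 4 :* x :^ 7) :* (c :* x :^ 5)
                     := :- (⟨1⟩ :^ 3 :* x :^ 7 :* c) :* (q :* x) :^ 5) refl q (q ^ n) (c 0 n))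

  e-z : ∀ n → e z n ≈ c 0 n * (q ^ n) ^ 2
  e-z zero    = solve 0 (⟨1⟩ := ⟨1⟩ :* ⟨1⟩ :^ 2) refl
  e-z (suc n) = trans (*-cong (-‿cong (*-congˡ (Q^n≈ n))) (e-z n))
    (solve 3 (λ q x c → :- (q :* q :* x :^ 7) :* (c :* x :^ 2)
                     := :- (⟨1⟩ :^ 3 :* x :^ 7 :* c) :* (q :* x) :^ 2) refl q (q ^ n) (c 0 n))

  -- The two halves of the n-th term of the J series are the summands of Σ (-1)^k q^(k(7k+3)/2) at k
  -- = n and k = -n - 1, whence the shift in `e z`.
  term-e : ∀ n → term 2 5 0 n ≈ e w n + e z (suc n)
  term-e n = begin
    c 0 n * x ^ 5 * (1# - (1# * x ^ 2 * q) ^ 2) * 1#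
      ≈⟨ solve 3 (λ q x c → c :* x :^ 5 :* (⟨1⟩ :- (⟨1⟩ :* x :^ 2 :* q) :^ 2) :* ⟨1⟩
           := c :* x :^ 5 :+ (:- (⟨1⟩ :^ 3 :* x :^ 7 :* c) :* (q :* x) :^ 2)) refl q x (c 0 n) ⟩
    c 0 n * x ^ 5 + c 0 (suc n) * (q * x) ^ 2
      ≈⟨ +-cong (e-w n) (e-z (suc n)) ⟨
    e w n + e z (suc n) ∎
    where x = q ^ n

  S≈product : S (suc (N ℕ.+ N)) 2 5 0 ≈ productSide
  S≈product = begin
    S (suc K) 2 5 0                                ≈⟨ Σ-cong (suc K) term-e ⟩
    Σ (suc K) (λ n → e w n + e z (suc n))          ≈⟨ Σ-+ (suc K) (e w) (e z ∘ suc) ⟩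
    (1# + Σ K (e w ∘ suc)) + Σ (suc K) (e z ∘ suc) ≈⟨ trans (+-congʳ (+-comm _ _)) (+-assoc _ _ _) ⟩
    Σ K (e w ∘ suc) + Σ (suc (suc K)) (e z)        ≈⟨ tripleProduct (suc K) (ℕ.m≤n⇒m≤1+n (ℕ.m≤m+n N N)) ⟨
    productSide                                    ∎
    where K = N ℕ.+ N

  gordon-product : ∀ {F H} → Solution (λ m → q ^ suc m) (λ m → (q ^ suc (suc m)) ^ 2) F H →
                   (∀ m → N ℕ.≤ m → F m ≈ 1#) → (∀ m → N ℕ.≤ m → H m ≈ 1#) →
                   ⟨q⟩∞ * F 0 ≈ productSide
  gordon-product s F-large H-large = trans
    (solution-unique (solution-*ˡ ⟨q⟩∞ s) (S-solution (suc K) (ℕ.m≤n⇒m≤1+n (ℕ.m≤m+n N N)))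
      (λ m N≤m → trans (one (F-large m N≤m)) (sym (S-large K 1 5 m N≤m)))
      (λ m N≤m → trans (one (H-large m N≤m)) (sym (S-large K 0 6 m N≤m))) 0)
    S≈product
    where
    K = N ℕ.+ N
    one : ∀ {x} → x ≈ 1# → ⟨q⟩∞ * x ≈ ⟨q⟩∞
    one x≈1 = trans (*-congˡ x≈1) (*-identityʳ _)

  module _ (a : ℕ → Carrier) (a-zero : a 0 ≈ 1#)
           (allowed   : ∀ r n → (r ≡ 0 ⊎ r ≡ 2 ⊎ r ≡ 3 ⊎ r ≡ 5) →
                        (1# - q ^ suc (r ℕ.+ n ℕ.* 7)) * a (suc (r ℕ.+ n ℕ.* 7)) ≈ a (r ℕ.+ n ℕ.* 7))
           (forbidden : ∀ r n → (r ≡ 1 ⊎ r ≡ 4 ⊎ r ≡ 6) →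
                        a (suc (r ℕ.+ n ℕ.* 7)) ≈ a (r ℕ.+ n ℕ.* 7)) where

    -- With `a k` the generating function for allowed parts up to k, the factor (q;q)_k cancels the
    -- allowed denominators and leaves the product of 1 - q^i over the forbidden i ≤ k.
    b : ℕ → Carrier
    b k = poch (q ^ 1) q k * a k

    b-allowed : ∀ r n → (r ≡ 0 ⊎ r ≡ 2 ⊎ r ≡ 3 ⊎ r ≡ 5) → b (suc (r ℕ.+ n ℕ.* 7)) ≈ b (r ℕ.+ n ℕ.* 7)
    b-allowed r n r≡ = begin
      poch (q ^ 1) q (suc k) * a (suc k)
        ≈⟨ *-congʳ (poch-last (q ^ 1) q k) ⟩
      poch (q ^ 1) q k * (1# - q * 1# * q ^ k) * a (suc k)
        ≈⟨ solve 4 (λ q x p a → p :* (⟨1⟩ :- q :* ⟨1⟩ :* x) :* a := p :* ((⟨1⟩ :- q :* x) :* a)) refl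
             q (q ^ k) (poch (q ^ 1) q k) (a (suc k)) ⟩
      poch (q ^ 1) q k * ((1# - q * q ^ k) * a (suc k))
        ≈⟨ *-congˡ (allowed r n r≡) ⟩
      b k ∎
      where k = r ℕ.+ n ℕ.* 7

    b-forbidden : ∀ r n → (r ≡ 1 ⊎ r ≡ 4 ⊎ r ≡ 6) →
                  b (suc (r ℕ.+ n ℕ.* 7)) ≈ (1# - q ^ suc (r ℕ.+ n ℕ.* 7)) * b (r ℕ.+ n ℕ.* 7)
    b-forbidden r n r≡ = begin
      poch (q ^ 1) q (suc k) * a (suc k)
        ≈⟨ *-cong (poch-last (q ^ 1) q k) (forbidden r n r≡) ⟩
      poch (q ^ 1) q k * (1# - q * 1# * q ^ k) * a k
        ≈⟨ solve 4 (λ q x p a → p :* (⟨1⟩ :- q :* ⟨1⟩ :* x) :* a := (⟨1⟩ :- q :* x) :* (p :* a)) refl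
             q (q ^ k) (poch (q ^ 1) q k) (a k) ⟩
      (1# - q * q ^ k) * b k ∎
      where k = r ℕ.+ n ℕ.* 7

    b-block : ∀ n → b (7 ℕ.+ n ℕ.* 7) ≈
      (1# - q ^ (7 ℕ.+ n ℕ.* 7)) * ((1# - q ^ (5 ℕ.+ n ℕ.* 7)) * ((1# - q ^ (2 ℕ.+ n ℕ.* 7)) * b (n ℕ.* 7)))
    b-block n =
      trans (b-forbidden 6 n (inj₂ (inj₂ ≡.refl))) (*-congˡ (
      trans (b-allowed 5 n (inj₂ (inj₂ (inj₂ ≡.refl)))) (
      trans (b-forbidden 4 n (inj₂ (inj₁ ≡.refl))) (*-congˡ (
      trans (b-allowed 3 n (inj₂ (inj₂ (inj₁ ≡.refl)))) (
      trans (b-allowed 2 n (inj₂ (inj₁ ≡.refl))) (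
      trans (b-forbidden 1 n (inj₁ ≡.refl)) (*-congˡ (
      b-allowed 0 n (inj₁ ≡.refl))))))))))

    -- Seven consecutive part sizes contribute exactly one factor to each of the three products.
    -- Reaching N factors therefore requires parts up to 7N on the side of A.
    b-product : ∀ n → b (n ℕ.* 7) ≈ poch w Q n * (poch z Q n * poch (Q ^ 1) Q n)
    b-product zero    = trans (*-identityˡ _) (trans a-zero (sym (trans (*-identityˡ _) (*-identityˡ _))))
    b-product (suc n) = begin
      b (7 ℕ.+ M)
        ≈⟨ b-block n ⟩
      (1# - q ^ (7 ℕ.+ M)) * ((1# - q ^ (5 ℕ.+ M)) * ((1# - q ^ (2 ℕ.+ M)) * b M))
        ≈⟨ *-congˡ (*-congˡ (*-congˡ (b-product n))) ⟩
      (1# - q ^ (7 ℕ.+ M)) * ((1# - q ^ (5 ℕ.+ M)) * ((1# - q ^ (2 ℕ.+ M)) * (pw * (pz * pQ))))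
        ≈⟨ solve 5 (λ q x pw pz pQ →
             (⟨1⟩ :- q :* (q :* (q :* (q :* (q :* (q :* (q :* x)))))))
               :* ((⟨1⟩ :- q :* (q :* (q :* (q :* (q :* x))))) :* ((⟨1⟩ :- q :* (q :* x)) :* (pw :* (pz :* pQ))))
             := pw :* (⟨1⟩ :- q :* q :^ 4 :* x) :* (pz :* (⟨1⟩ :- q :* q :* x)
                  :* (pQ :* (⟨1⟩ :- q :* q :* (q :* q :^ 4) :* ⟨1⟩ :* x)))) refl q (q ^ M) pw pz pQ ⟩
      pw * (1# - w * q ^ M) * (pz * (1# - z * q ^ M) * (pQ * (1# - Q ^ 1 * q ^ M)))
        ≈⟨ *-cong (factor w) (*-cong (factor z) (factor (Q ^ 1))) ⟨
      poch w Q (suc n) * (poch z Q (suc n) * poch (Q ^ 1) Q (suc n)) ∎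
      where
      M = n ℕ.* 7
      pw = poch w Q n
      pz = poch z Q n
      pQ = poch (Q ^ 1) Q n
      factor : ∀ u → poch u Q (suc n) ≈ poch u Q n * (1# - u * q ^ M)
      factor u = trans (poch-last u Q n)
        (*-congˡ (+-congˡ (-‿cong (*-congˡ (trans (Q^n≈ n) (^-assocʳ q n 7))))))

    congruence-product : ⟨q⟩∞ * a (N ℕ.* 7) ≈ productSide
    congruence-product = begin
      poch (q ^ 1) q N * a (N ℕ.* 7)
        ≈⟨ *-congʳ (poch-stable (q ^ 1) q N (N ℕ.* 6) (*0≈0 q^N≈0)) ⟨
      poch (q ^ 1) q (N ℕ.* 6 ℕ.+ N) * a (N ℕ.* 7)
        ≡⟨ ≡.cong (λ k → poch (q ^ 1) q k * a (N ℕ.* 7)) (≡.trans (ℕ.+-comm (N ℕ.* 6) N) (≡.sym (ℕ.*-suc N 6))) ⟩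
      b (N ℕ.* 7)
        ≈⟨ b-product N ⟩
      productSide ∎

    gordon : ∀ {F H} → Solution (λ m → q ^ suc m) (λ m → (q ^ suc (suc m)) ^ 2) F H →
             (∀ m → N ℕ.≤ m → F m ≈ 1#) → (∀ m → N ℕ.≤ m → H m ≈ 1#) →
             a (N ℕ.* 7) ≈ F 0
    gordon s F-large H-large = poch-cancel 1# q N
      (trans congruence-product (sym (gordon-product s F-large H-large)))

  -- The recurrence in two indices for C

  module _ (G : ℕ → ℕ → Carrier)
           (G-step : ∀ i d → G i d ≈ (1# + q ^ (i ℕ.+ d)) * G i (suc d)
                                      + (q ^ suc d) ^ 2 * G (suc i) (suc (suc d)))
           (G-large : ∀ i d → N ℕ.≤ d → G i d ≈ 1#) where

    -- Neither relation can be proved alone: the second at (i, d) uses the first at (i, d+1) and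
    -- (i+1, d+2) together with the second at (i, d+1), and the first then follows from `G-step`.
    -- Hence the joint induction, downwards in d and for all i at once; for `d ≥ N` every `G i d` is
    -- 1.
    G-relations : ∀ k i d → N ℕ.≤ k ℕ.+ d →
      (G i d ≈ G (suc i) d + q ^ (i ℕ.+ d) * G i (suc d)) ×
      (G (suc i) d ≈ G i (suc d) + (q ^ suc d) ^ 2 * G (suc i) (suc (suc d)))
    G-relations zero i d N≤d = large (λ j → G-large j d N≤d) (q^≈0 (ℕ.m≤n⇒m≤o+n i N≤d)) ,
      trans (G-large (suc i) d N≤d) (sym (trans
        (+-cong (G-large i (suc d) (ℕ.m≤n⇒m≤1+n N≤d)) (0*≈0 (0*≈0 (q^≈0 (ℕ.m≤n⇒m≤1+n N≤d)))))
        (+-identityʳ 1#)))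
      where
      large : (∀ j → G j d ≈ 1#) → ∀ {x y} → x ≈ 0# → G i d ≈ G (suc i) d + x * y
      large C≈1 x≈0 = trans (C≈1 i) (sym (trans (+-cong (C≈1 (suc i)) (0*≈0 x≈0)) (+-identityʳ 1#)))
    G-relations (suc k) i d N≤ = Δ , Γ
      where
      N≤₁ : N ℕ.≤ k ℕ.+ suc d
      N≤₁ = ℕ.≤-trans N≤ (ℕ.≤-reflexive (≡.sym (ℕ.+-suc k d)))
      N≤₂ : N ℕ.≤ k ℕ.+ suc (suc d)
      N≤₂ = ℕ.≤-trans N≤₁ (ℕ.+-monoʳ-≤ k (ℕ.n≤1+n (suc d)))
      x y : Carrier
      x = q ^ d
      y = q ^ (i ℕ.+ d)
      Δ₁ : G i (suc d) ≈ G (suc i) (suc d) + q * y * G i (suc (suc d))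
      Δ₁ = trans (proj₁ (G-relations k i (suc d) N≤₁)) (+-congˡ (*-congʳ (^-congʳ q (ℕ.+-suc i d))))
      Γ₁ : G (suc i) (suc d) ≈ G i (suc (suc d)) + (q * (q * x)) ^ 2 * G (suc i) (suc (suc (suc d)))
      Γ₁ = proj₂ (G-relations k i (suc d) N≤₁)
      Δ₂ : G (suc i) (suc (suc d)) ≈
           G (suc (suc i)) (suc (suc d)) + q * (q * (q * y)) * G (suc i) (suc (suc (suc d)))
      Δ₂ = trans (proj₁ (G-relations k (suc i) (suc (suc d)) N≤₂))
                 (+-congˡ (*-congʳ (^-congʳ q (≡.cong suc (≡.trans (ℕ.+-suc i (suc d)) (≡.cong suc (ℕ.+-suc i d)))))))
      Γ : G (suc i) d ≈ G i (suc d) + (q * x) ^ 2 * G (suc i) (suc (suc d))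
      Γ = begin
        G (suc i) d
          ≈⟨ G-step (suc i) d ⟩
        (1# + q * y) * G (suc i) (suc d) + (q * x) ^ 2 * h
          ≈⟨ solve 3 (λ v b r → (⟨1⟩ :+ v) :* b :+ r := b :+ v :* b :+ r) refl
               (q * y) (G (suc i) (suc d)) ((q * x) ^ 2 * h) ⟩
        G (suc i) (suc d) + q * y * G (suc i) (suc d) + (q * x) ^ 2 * h
          -- Only the copy of `G (suc i) (suc d)` with factor q^(i+d+1) is expanded. As q^(i+d+1)
          -- q^(2d+4) = q^(2d+2) q^(i+d+3), the pieces regroup into the right-hand sides of `Δ₁` and
          -- `Δ₂`.
          ≈⟨ +-congʳ (+-congˡ (*-congˡ Γ₁)) ⟩
        G (suc i) (suc d) + q * y * (a + (q * (q * x)) ^ 2 * g) + (q * x) ^ 2 * h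
          ≈⟨ solve 7 (λ q x y a b g h →
               b :+ q :* y :* (a :+ (q :* (q :* x)) :^ 2 :* g) :+ (q :* x) :^ 2 :* h
               := b :+ q :* y :* a :+ (q :* x) :^ 2 :* (h :+ q :* (q :* (q :* y)) :* g)) refl
               q x y a (G (suc i) (suc d)) g h ⟩
        G (suc i) (suc d) + q * y * a + (q * x) ^ 2 * (h + q * (q * (q * y)) * g)
          ≈⟨ +-cong Δ₁ (*-congˡ Δ₂) ⟨
        G i (suc d) + (q * x) ^ 2 * G (suc i) (suc (suc d)) ∎
        where
        a = G i (suc (suc d))
        g = G (suc i) (suc (suc (suc d)))
        h = G (suc (suc i)) (suc (suc d))
      Δ : G i d ≈ G (suc i) d + y * G i (suc d)
      Δ = begin
        G i d
          ≈⟨ G-step i d ⟩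
        (1# + y) * G i (suc d) + (q * x) ^ 2 * G (suc i) (suc (suc d))
          ≈⟨ solve 3 (λ y a r → (⟨1⟩ :+ y) :* a :+ r := (a :+ r) :+ y :* a) refl y (G i (suc d)) _ ⟩
        (G i (suc d) + (q * x) ^ 2 * G (suc i) (suc (suc d))) + y * G i (suc d)
          ≈⟨ +-congʳ Γ ⟨
        G (suc i) d + y * G i (suc d) ∎

    G-solution : Solution (λ m → q ^ suc m) (λ m → (q ^ suc (suc m)) ^ 2) (G 0 ∘ suc) (G 1 ∘ suc)
    G-solution = record
      { F-step = λ m → proj₁ (G-relations N 0 (suc m) (ℕ.m≤m+n N (suc m)))
      ; H-step = λ m → proj₂ (G-relations N 0 (suc m) (ℕ.m≤m+n N (suc m)))
      }

    G≈F : ∀ {F H} → Solution (λ m → q ^ suc m) (λ m → (q ^ suc (suc m)) ^ 2) F H →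
          (∀ m → N ℕ.≤ m → F m ≈ 1#) → (∀ m → N ℕ.≤ m → H m ≈ 1#) →
          F 0 ≈ G 0 1
    G≈F s F-large H-large = solution-unique s G-solution
      (λ m N≤m → trans (F-large m N≤m) (sym (G-large 0 (suc m) (ℕ.m≤n⇒m≤1+n N≤m))))
      (λ m N≤m → trans (H-large m N≤m) (sym (G-large 1 (suc m) (ℕ.m≤n⇒m≤1+n N≤m)))) 0

  square-exponent : ∀ k x y z → x ≈ y + q ^ (2 ℕ.* k) * z → x ≈ y + (q ^ k) ^ 2 * z
  square-exponent k x y z eq = trans eq
    (+-congˡ (*-congʳ (trans (^-congʳ q (ℕ.*-comm 2 k)) (sym (^-assocʳ q k 2)))))

  eliminate : ∀ k l x h y z → x ≈ h + q ^ l * y → h ≈ y + q ^ (2 ℕ.* k) * z →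
              x ≈ (1# + q ^ l) * y + (q ^ k) ^ 2 * z
  eliminate k l x h y z x≈ h≈ = begin
    x                                       ≈⟨ x≈ ⟩
    h + q ^ l * y                           ≈⟨ +-congʳ (square-exponent k h y z h≈) ⟩
    y + (q ^ k) ^ 2 * z + q ^ l * y         ≈⟨ solve 3 (λ y r v → y :+ r :+ v :* y := (⟨1⟩ :+ v) :* y :+ r) refl
                                                 y ((q ^ k) ^ 2 * z) (q ^ l) ⟩
    (1# + q ^ l) * y + (q ^ k) ^ 2 * z      ∎

  isolate : ∀ v x y → x ≈ y + v * x → (1# - v) * x ≈ y
  isolate v x y eq = begin
    (1# - v) * x       ≈⟨ solve 2 (λ v x → (⟨1⟩ :- v) :* x := x :- v :* x) refl v x ⟩
    x - v * x          ≈⟨ +-congʳ eq ⟩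
    (y + v * x) - v * x ≈⟨ solve 2 (λ y r → (y :+ r) :- r := y) refl y (v * x) ⟩
    y                  ∎

-- Truncated power series

Series : Set
Series = ℕ → ℤ

-- The Cauchy product, by recursion along f = f(0) + q · (tail of f); the ring laws become plain
-- inductions without reindexing of sums.
mul : Series → Series → Series
mul f g zero    = f 0 ℤ.* g 0
mul f g (suc n) = f 0 ℤ.* g (suc n) ℤ.+ mul (f ∘ suc) g n

mul-cong : ∀ {f f′ g g′} n → (∀ i → i ℕ.≤ n → f i ≡ f′ i) → (∀ i → i ℕ.≤ n → g i ≡ g′ i) →
           mul f g n ≡ mul f′ g′ n
mul-cong zero    f≡ g≡ = ≡.cong₂ ℤ._*_ (f≡ 0 z≤n) (g≡ 0 z≤n)
mul-cong (suc n) f≡ g≡ = ≡.cong₂ ℤ._+_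
  (≡.cong₂ ℤ._*_ (f≡ 0 z≤n) (g≡ (suc n) ℕ.≤-refl))
  (mul-cong n (λ i i≤n → f≡ (suc i) (s≤s i≤n)) (λ i i≤n → g≡ i (ℕ.m≤n⇒m≤1+n i≤n)))

mul-tailʳ : ∀ f g n → mul f g (suc n) ≡ mul f (g ∘ suc) n ℤ.+ f (suc n) ℤ.* g 0
mul-tailʳ f g zero    = ≡.refl
mul-tailʳ f g (suc n) = ≡.trans (≡.cong (λ y → f 0 ℤ.* g (suc (suc n)) ℤ.+ y) (mul-tailʳ (f ∘ suc) g n))
                                (≡.sym (ℤ.+-assoc (f 0 ℤ.* g (suc (suc n))) _ _))

mul-comm : ∀ f g n → mul f g n ≡ mul g f n
mul-comm f g zero    = ℤ.*-comm (f 0) (g 0)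
mul-comm f g (suc n) = ≡.trans
  (≡.cong₂ ℤ._+_ (ℤ.*-comm (f 0) (g (suc n))) (mul-comm (f ∘ suc) g n))
  (≡.trans (ℤ.+-comm (g (suc n) ℤ.* f 0) _) (≡.sym (mul-tailʳ g f n)))

mul-distribʳ : ∀ f g h n → mul (λ i → g i ℤ.+ h i) f n ≡ mul g f n ℤ.+ mul h f n
mul-distribʳ f g h zero    = ℤ.*-distribʳ-+ (f 0) (g 0) (h 0)
mul-distribʳ f g h (suc n) = ≡.trans
  (≡.cong (λ y → (g 0 ℤ.+ h 0) ℤ.* f (suc n) ℤ.+ y) (mul-distribʳ f (g ∘ suc) (h ∘ suc) n))
  (lemma (g 0) (h 0) (f (suc n)) (mul (g ∘ suc) f n) (mul (h ∘ suc) f n))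
  where
  lemma : ∀ a b c x y → (a ℤ.+ b) ℤ.* c ℤ.+ (x ℤ.+ y) ≡ (a ℤ.* c ℤ.+ x) ℤ.+ (b ℤ.* c ℤ.+ y)
  lemma = solve-∀

mul-scaleˡ : ∀ a f g n → mul (λ i → a ℤ.* f i) g n ≡ a ℤ.* mul f g n
mul-scaleˡ a f g zero    = ℤ.*-assoc a (f 0) (g 0)
mul-scaleˡ a f g (suc n) = ≡.trans
  (≡.cong (λ y → a ℤ.* f 0 ℤ.* g (suc n) ℤ.+ y) (mul-scaleˡ a (f ∘ suc) g n))
  (lemma a (f 0) (g (suc n)) (mul (f ∘ suc) g n))
  where
  lemma : ∀ a b c x → a ℤ.* b ℤ.* c ℤ.+ a ℤ.* x ≡ a ℤ.* (b ℤ.* c ℤ.+ x)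
  lemma = solve-∀

mul-assoc : ∀ f g h n → mul (mul f g) h n ≡ mul f (mul g h) n
mul-assoc f g h zero    = ℤ.*-assoc (f 0) (g 0) (h 0)
mul-assoc f g h (suc n) = ≡.trans
  (≡.cong (λ y → f 0 ℤ.* g 0 ℤ.* h (suc n) ℤ.+ y) (≡.trans
    (mul-distribʳ h (λ i → f 0 ℤ.* g (suc i)) (mul (f ∘ suc) g) n)
    (≡.cong₂ ℤ._+_ (mul-scaleˡ (f 0) (g ∘ suc) h n) (mul-assoc (f ∘ suc) g h n))))
  (lemma (f 0) (g 0) (h (suc n)) (mul (g ∘ suc) h n) (mul (f ∘ suc) (mul g h) n))
  where
  lemma : ∀ a b c x y → a ℤ.* b ℤ.* c ℤ.+ (a ℤ.* x ℤ.+ y) ≡ a ℤ.* (b ℤ.* c ℤ.+ x) ℤ.+ y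
  lemma = solve-∀

mul-zeroˡ : ∀ g n → mul (const 0ℤ) g n ≡ 0ℤ
mul-zeroˡ g zero    = ≡.refl
mul-zeroˡ g (suc n) = ≡.trans (ℤ.+-identityˡ _) (mul-zeroˡ g n)

one : Series
one zero    = 1ℤ
one (suc _) = 0ℤ

mul-identityˡ : ∀ g n → mul one g n ≡ g n
mul-identityˡ g zero    = ℤ.*-identityˡ (g 0)
mul-identityˡ g (suc n) = ≡.trans
  (≡.cong₂ ℤ._+_ (ℤ.*-identityˡ (g (suc n))) (mul-zeroˡ g n)) (ℤ.+-identityʳ _)

-- ℤ[[q]] modulo q^N.
TruncatedSeries : ℕ → CommutativeRing 0ℓ 0ℓ
TruncatedSeries N = record
  { Carrier = Series
  ; _≈_ = λ f g → ∀ i → i ℕ.< N → f i ≡ g i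
  ; _+_ = λ f g i → f i ℤ.+ g i
  ; _*_ = mul
  ; -_  = λ f i → ℤ.- f i
  ; 0#  = const 0ℤ
  ; 1#  = one
  ; isCommutativeRing = record
    { isRing = record
      { +-isAbelianGroup = record
        { isGroup = record
          { isMonoid = record
            { isSemigroup = record
              { isMagma = record
                { isEquivalence = record
                  { refl  = λ _ _ → ≡.refl
                  ; sym   = λ p i i<N → ≡.sym (p i i<N)
                  ; trans = λ p r i i<N → ≡.trans (p i i<N) (r i i<N)
                  }
                ; ∙-cong = λ p r i i<N → ≡.cong₂ ℤ._+_ (p i i<N) (r i i<N)
                }
              ; assoc = λ f g h i _ → ℤ.+-assoc (f i) (g i) (h i)
              }
            ; identity = (λ f i _ → ℤ.+-identityˡ (f i)) , (λ f i _ → ℤ.+-identityʳ (f i))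
            }
          ; inverse = (λ f i _ → ℤ.+-inverseˡ (f i)) , (λ f i _ → ℤ.+-inverseʳ (f i))
          ; ⁻¹-cong = λ p i i<N → ≡.cong ℤ.-_ (p i i<N)
          }
        ; comm = λ f g i _ → ℤ.+-comm (f i) (g i)
        }
      ; *-cong = λ p r i i<N → mul-cong i (λ j j≤i → p j (ℕ.≤-<-trans j≤i i<N))
                                          (λ j j≤i → r j (ℕ.≤-<-trans j≤i i<N))
      ; *-assoc = λ f g h i _ → mul-assoc f g h i
      ; *-identity = (λ f i _ → mul-identityˡ f i) ,
                     (λ f i _ → ≡.trans (mul-comm f one i) (mul-identityˡ f i))
      ; distrib = (λ f g h i _ → ≡.trans (mul-comm f (λ j → g j ℤ.+ h j) i)
                    (≡.trans (mul-distribʳ f g h i) (≡.cong₂ ℤ._+_ (mul-comm g f i) (mul-comm h f i))))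
                , (λ f g h i _ → mul-distribʳ f g h i)
      }
    ; *-comm = λ f g i _ → mul-comm f g i
    }
  }

indeterminate : Series
indeterminate zero    = 0ℤ
indeterminate (suc n) = one n

module Monomials (N : ℕ) where
  open CommutativeRing (TruncatedSeries N)
  open Algebra.Properties.Semiring.Exp semiring

  shift-suc : ∀ f i → mul indeterminate f (suc i) ≡ f i
  shift-suc f i = ≡.trans (ℤ.+-identityˡ _) (mul-identityˡ f i)

  -- Valid at every index, also beyond N: truncation affects only the equality of the ring, not its
  -- operations.
  monomial-≥ : ∀ m f i → mul (indeterminate ^ m) f (m ℕ.+ i) ≡ f i
  monomial-≥ zero    f i = mul-identityˡ f i
  monomial-≥ (suc m) f i = ≡.trans (mul-assoc indeterminate (indeterminate ^ m) f (suc m ℕ.+ i))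
    (≡.trans (shift-suc (mul (indeterminate ^ m) f) (m ℕ.+ i)) (monomial-≥ m f i))

  monomial-< : ∀ m f i → i ℕ.< m → mul (indeterminate ^ m) f i ≡ 0ℤ
  monomial-< (suc m) f zero    _         = ≡.refl
  monomial-< (suc m) f (suc i) (s≤s i<m) = ≡.trans (mul-assoc indeterminate (indeterminate ^ m) f (suc i))
    (≡.trans (shift-suc (mul (indeterminate ^ m) f) i) (monomial-< m f i i<m))

  indeterminate^N≈0 : HasZeroPower (TruncatedSeries N) indeterminate N
  indeterminate^N≈0 i i<N = ≡.trans (≡.sym (*-identityʳ (indeterminate ^ N) i i<N))
                                    (monomial-< N one i i<N)

-- Counting by weight

open Enumeration
open ≡ using (refl)

image : ∀ {X Y : Set} {P : X → Set} {Q : Y → Set} (f : Y → X) → Injective _≡_ _≡_ f →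
        (∀ {y} → Q y → P (f y)) → (∀ {x} → P x → ∃ λ y → Q y × x ≡ f y) →
        Enumeration Q → Enumeration P
image {P = P} f f-inj to from e = record
  { elements = map f (elements e)
  ; unique   = Unique.map⁺ f-inj (unique e)
  ; sound    = snd
  ; complete = λ Px → let (y , Qy , x≡fy) = from Px in
      ≡.subst (_∈ map f (elements e)) (≡.sym x≡fy) (∈-map⁺ f (complete e Qy))
  }
  where
  snd : ∀ {x} → x ∈ map f (elements e) → P x
  snd x∈ with ∈-map⁻ f x∈
  ... | y , y∈ , refl = to (sound e y∈)

union : ∀ {X : Set} {P Q R : X → Set} →
        (∀ {x} → Q x → P x) → (∀ {x} → R x → P x) → (∀ {x} → P x → Q x ⊎ R x) →
        (∀ {x} → Q x → ¬ R x) → Enumeration Q → Enumeration R → Enumeration P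
union {P = P} Q⇒P R⇒P P⇒Q⊎R disjoint e e′ = record
  { elements = elements e ++ elements e′
  ; unique   = Unique.++⁺ (unique e) (unique e′) (λ (x∈ , x∈′) → disjoint (sound e x∈) (sound e′ x∈′))
  ; sound    = snd
  ; complete = cmp
  }
  where
  snd : ∀ {x} → x ∈ elements e ++ elements e′ → P x
  snd x∈ with ∈-++⁻ (elements e) x∈
  ... | inj₁ x∈₁ = Q⇒P (sound e x∈₁)
  ... | inj₂ x∈₂ = R⇒P (sound e′ x∈₂)
  cmp : ∀ {x} → P x → x ∈ elements e ++ elements e′
  cmp Px with P⇒Q⊎R Px
  ... | inj₁ Qx = ∈-++⁺ˡ (complete e Qx)
  ... | inj₂ Rx = ∈-++⁺ʳ (elements e) (complete e′ Rx)

module Weighted {X : Set} (weight : X → ℕ) where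

  Level : (X → Set) → ℕ → Set
  Level P s = Enumeration (λ x → P x × weight x ≡ s)

  series : ∀ {P} → (∀ s → Level P s) → Series
  series e s = + number (e s)

  -- A disjoint decomposition of P into Q and the image of R under a map that adds k to the weight;
  -- for generating functions, P = Q + q^k R. The same data assembles an enumeration of P from those
  -- of Q and R (`level`), so configurations are enumerated without deciding any predicate.
  record Step (P Q R : X → Set) (k : ℕ) : Set where
    field
      f        : X → X
      f-inj    : Injective _≡_ _≡_ f
      f-weight : ∀ y → weight (f y) ≡ k ℕ.+ weight y
      from-Q   : ∀ {x} → Q x → P x
      from-R   : ∀ {y} → R y → P (f y)
      split    : ∀ {x} → P x → Q x ⊎ ∃ λ y → R y × x ≡ f y
      disjoint : ∀ {y} → R y → ¬ Q (f y)

    level-≥ : ∀ s → Level Q (k ℕ.+ s) → Level R s → Level P (k ℕ.+ s)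
    level-≥ s eQ eR = union {R = λ x → ∃ λ y → (R y × weight y ≡ s) × x ≡ f y}
      (λ (Qx , w) → from-Q Qx , w)
      (λ { (y , (Ry , w) , refl) → from-R Ry , ≡.trans (f-weight y) (≡.cong (k ℕ.+_) w) })
      (λ (Px , w) → to (split Px) w)
      (λ { (Qx , _) (y , (Ry , _) , refl) → disjoint Ry Qx })
      eQ (image f f-inj (λ Ry → _ , Ry , refl) (λ { (y , Ry , eq) → y , Ry , eq }) eR)
      where
      to : ∀ {x} → Q x ⊎ (∃ λ y → R y × x ≡ f y) → weight x ≡ k ℕ.+ s →
           (Q x × weight x ≡ k ℕ.+ s) ⊎ (∃ λ y → (R y × weight y ≡ s) × x ≡ f y)
      to (inj₁ Qx) w = inj₁ (Qx , w)
      to (inj₂ (y , Ry , refl)) w =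
        inj₂ (y , (Ry , ℕ.+-cancelˡ-≡ k _ _ (≡.trans (≡.sym (f-weight y)) w)) , refl)

    level-< : ∀ s → s ℕ.< k → Level Q s → Level P s
    level-< s s<k = image id id (λ (Qx , w) → from-Q Qx , w) (λ {x} (Px , w) → x , to (split Px) w , refl)
      where
      to : ∀ {x} → Q x ⊎ (∃ λ y → R y × x ≡ f y) → weight x ≡ s → Q x × weight x ≡ s
      to (inj₁ Qx) w = Qx , w
      to (inj₂ (y , Ry , refl)) w =
        ⊥-elim (ℕ.<⇒≱ s<k (≡.subst (k ℕ.≤_) (≡.trans (≡.sym (f-weight y)) w) (ℕ.m≤m+n k (weight y))))

    level : ∀ s → Level Q s → (k ℕ.≤ s → Level R (s ℕ.∸ k)) → Level P s
    level s eQ eR with k ℕ.≤? s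
    ... | no k≰s = level-< s (ℕ.≰⇒> k≰s) eQ
    ... | yes k≤s = ≡.subst (Level P) k+[s∸k]≡s (level-≥ (s ℕ.∸ k) (≡.subst (Level Q) (≡.sym k+[s∸k]≡s) eQ) (eR k≤s))
      where k+[s∸k]≡s = ℕ.m+[n∸m]≡n k≤s

    number-≥ : ∀ s eQ eR → number (level-≥ s eQ eR) ≡ number eQ ℕ.+ number eR
    number-≥ s eQ eR = ≡.trans (length-++ (elements eQ)) (≡.cong (number eQ ℕ.+_) (length-map f (elements eR)))

    number-< : ∀ s s<k eQ → number (level-< s s<k eQ) ≡ number eQ
    number-< s s<k eQ = length-map id (elements eQ)

  -- The three enumerations are arbitrary: by `number-unique` each coefficient can be read off the
  -- enumeration of P assembled from those of Q and R.
  step-series : ∀ {P Q R k} → Step P Q R k → ∀ N (eP : ∀ s → Level P s) (eQ : ∀ s → Level Q s) (eR : ∀ s → Level R s) →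
                let open CommutativeRing (TruncatedSeries N)
                    open Algebra.Properties.Semiring.Exp semiring in
                series eP ≈ series eQ + indeterminate ^ k * series eR
  step-series {P} {Q} {R} {k} st N eP eQ eR s _ with k ℕ.≤? s
  ... | no k≰s = ≡.trans
      (≡.cong +_ (≡.trans (number-unique (eP s) (level-< s s<k (eQ s))) (number-< s s<k (eQ s))))
      (≡.trans (≡.sym (ℤ.+-identityʳ _)) (≡.cong (λ y → + number (eQ s) ℤ.+ y)
        (≡.sym (monomial-< k (series eR) s s<k))))
    where
    open Step st
    open Monomials N
    s<k = ℕ.≰⇒> k≰s
  ... | yes k≤s = ≡.subst Goal (ℕ.m+[n∸m]≡n k≤s) (≡.trans
      (≡.cong +_ (≡.trans (number-unique (eP (k ℕ.+ d)) (level-≥ d (eQ (k ℕ.+ d)) (eR d)))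
                          (number-≥ d (eQ (k ℕ.+ d)) (eR d))))
      (≡.cong (λ y → + number (eQ (k ℕ.+ d)) ℤ.+ y)
        (≡.sym (monomial-≥ k (series eR) d))))
    where
    open Step st
    open Monomials N
    open CommutativeRing (TruncatedSeries N) using (_+_; _*_; semiring)
    open Algebra.Properties.Semiring.Exp semiring
    d = s ℕ.∸ k
    Goal : ℕ → Set
    Goal s = series eP s ≡ (series eQ + indeterminate ^ k * series eR) s

open import Data.Nat.Base using (_+_; _*_; _∸_; _≤_; _<_)
open import Data.Nat.ListAction using (sum)

-- Bipartitions as configurations

Apart : ℕ → ℕ → Set
Apart g l = 2 + l ≤ g ⊎ 2 + g ≤ l

-- The i-th entry f of P (counting from 0) keeps L away from c + iδ + f and its two neighbours;
-- δ = 0 describes AvoidsB and δ = 1 describes AvoidsC.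
data Avoids (δ : ℕ) : ℕ → List ℕ → List ℕ → Set where
  []  : ∀ {c L} → Avoids δ c [] L
  _∷_ : ∀ {c f P L} → All (Apart (c + f)) L → Avoids δ (δ + c) P L → Avoids δ c (f ∷ P) L

-- P lists the halves of the parts of π, L the parts of the other partition, both in ascending order.
record Configuration (δ c d e : ℕ) (PL : List ℕ × List ℕ) : Set where
  constructor configuration
  field
    P≥     : All (d ≤_) (proj₁ PL)
    gaps   : AllPairs (λ a b → 2 + a ≤ b) (proj₁ PL)
    L≥     : All (e ≤_) (proj₂ PL)
    strict : AllPairs _<_ (proj₂ PL)
    avoids : Avoids δ c (proj₁ PL) (proj₂ PL)
open Configuration

weight : List ℕ × List ℕ → ℕ
weight (P , L) = 2 * sum P + sum L

open Weighted weight

P-weaken : ∀ {δ c d d′ e x} → d ≤ d′ → Configuration δ c d′ e x → Configuration δ c d e x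
P-weaken d≤ (configuration p g l s a) = configuration (All.map (ℕ.≤-trans d≤) p) g l s a

L-weaken : ∀ {δ c d e e′ x} → e ≤ e′ → Configuration δ c d e′ x → Configuration δ c d e x
L-weaken e≤ (configuration p g l s a) = configuration p g (All.map (ℕ.≤-trans e≤) l) s a

-- Offsets only grow along P, so distance from l at the first offset c implies it at all later ones.
avoids-cons : ∀ {δ c P L l} → All (λ f → 2 + l ≤ c + f) P → Avoids δ c P L → Avoids δ c P (l ∷ L)
avoids-cons []         []       = []
avoids-cons {δ} {c} (l< ∷ ls<) (a ∷ as) = (inj₁ l< ∷ a) ∷
  avoids-cons (All.map (λ {f} l<f → ℕ.≤-trans l<f (ℕ.+-monoˡ-≤ f (ℕ.m≤n+m c δ))) ls<) as

avoids-tail : ∀ {δ c P L l} → Avoids δ c P (l ∷ L) → Avoids δ c P L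
avoids-tail []             = []
avoids-tail ((_ ∷ a) ∷ as) = a ∷ avoids-tail as

2+[c+d] : ∀ c d → 2 + (c + d) ≡ c + (2 + d)
2+[c+d] c d = ≡.sym (≡.trans (ℕ.+-suc c (suc d)) (≡.cong suc (ℕ.+-suc c d)))

-- If c + d lies in L, a least half d + 1 would exclude it, so that half cannot occur; the later
-- halves are large enough by the gap condition.
P>head : ∀ {δ c d P L} → All (suc d ≤_) P → AllPairs (λ a b → 2 + a ≤ b) P →
         Avoids δ c P (c + d ∷ L) → All (2 + d ≤_) P
P>head [] [] [] = []
P>head {δ} {c} {d} {f ∷ P} (d<f ∷ _) (f< ∷ _) ((apart ∷ _) ∷ _) =
  d+2≤f apart ∷ All.map (λ f+2≤ → ℕ.≤-trans (ℕ.+-monoʳ-≤ 1 d<f) (ℕ.≤-trans (ℕ.n≤1+n (suc f)) f+2≤)) f<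
  where
  d+2≤f : Apart (c + f) (c + d) → 2 + d ≤ f
  d+2≤f (inj₁ p) = ℕ.+-cancelˡ-≤ c _ _ (≡.subst (_≤ c + f) (2+[c+d] c d) p)
  d+2≤f (inj₂ p) = ⊥-elim (ℕ.<⇒≱ d<f (ℕ.+-cancelˡ-≤ c _ _ (ℕ.≤-trans (ℕ.m≤n+m (c + f) 2) p)))

L-step : ∀ δ c d → Step (Configuration δ c (suc d) (c + d)) (Configuration δ c (suc d) (suc (c + d)))
                        (Configuration δ c (suc (suc d)) (suc (c + d))) (c + d)
L-step δ c d = record
  { f        = λ (P , L) → P , c + d ∷ L
  ; f-inj    = λ { refl → refl }
  ; f-weight = λ (P , L) → solve 3 (λ p m l → p :+ (m :+ l) := m :+ (p :+ l)) refl (2 * sum P) (c + d) (sum L)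
  ; from-Q   = L-weaken (ℕ.n≤1+n (c + d))
  ; from-R   = λ k → configuration
      (All.map (ℕ.≤-trans (ℕ.n≤1+n (suc d))) (P≥ k)) (gaps k)
      (ℕ.≤-refl ∷ All.map (ℕ.≤-trans (ℕ.n≤1+n (c + d))) (L≥ k)) (L≥ k ∷ strict k)
      (avoids-cons (All.map (λ {f} d+2≤f → ≡.subst (_≤ c + f) (≡.sym (2+[c+d] c d)) (ℕ.+-monoʳ-≤ c d+2≤f)) (P≥ k))
                   (avoids k))
  ; split    = spl
  ; disjoint = λ _ k → ℕ.1+n≰n (All.head (L≥ k))
  }
  where
  open +-*-Solver
  spl : ∀ {x} → Configuration δ c (suc d) (c + d) x →
        Configuration δ c (suc d) (suc (c + d)) x ⊎
        ∃ λ y → Configuration δ c (suc (suc d)) (suc (c + d)) y × x ≡ (proj₁ y , c + d ∷ proj₂ y)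
  spl (configuration p g [] s a) = inj₁ (configuration p g [] s a)
  spl {_ , l ∷ L} (configuration p g (l≥ ∷ _) (l< ∷ s) a) with ℕ.m≤n⇒m<n∨m≡n l≥
  ... | inj₁ l> = inj₁ (configuration p g (l> ∷ All.map (ℕ.≤-trans (s≤s l≥)) l<) (l< ∷ s) a)
  ... | inj₂ refl = inj₂ (_ , configuration (P>head p g a) g l< s (avoids-tail a) , refl)

-- A half d + 1 excludes c + d, c + d + 1 and c + d + 2. The first is already below the bound on L,
-- so the other two raise that bound to c + d + 3, while the offset for the remaining halves grows
-- by δ.
P-step : ∀ δ c d → Step (Configuration δ c (suc d) (suc (c + d))) (Configuration δ c (suc (suc d)) (suc (c + d)))
                        (Configuration δ (δ + c) (3 + d) (3 + (c + d))) (2 * suc d)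
P-step δ c d = record
  { f        = λ (P , L) → suc d ∷ P , L
  ; f-inj    = λ { refl → refl }
  ; f-weight = λ (P , L) → solve 3 (λ d p l → con 2 :* (d :+ p) :+ l := con 2 :* d :+ (con 2 :* p :+ l)) refl
                 (suc d) (sum P) (sum L)
  ; from-Q   = P-weaken (ℕ.n≤1+n (suc d))
  ; from-R   = λ k → configuration
      (ℕ.≤-refl ∷ All.map (ℕ.≤-trans (ℕ.m≤n+m (suc d) 2)) (P≥ k)) (P≥ k ∷ gaps k)
      (All.map (ℕ.≤-trans (ℕ.m≤n+m (suc (c + d)) 2)) (L≥ k)) (strict k)
      (All.map (λ {l} p → inj₂ (≡.subst (λ m → 2 + m ≤ l) (≡.sym (ℕ.+-suc c d)) p)) (L≥ k) ∷ avoids k)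
  ; split    = spl
  ; disjoint = λ _ k → ℕ.1+n≰n (All.head (P≥ k))
  }
  where
  open +-*-Solver
  far : ∀ {l} → suc (c + d) ≤ l × Apart (c + suc d) l → 3 + (c + d) ≤ l
  far {l} (l≥ , inj₁ p) = ⊥-elim (ℕ.<⇒≱ (ℕ.≤-trans (ℕ.n≤1+n (suc l)) p)
                                        (≡.subst (_≤ l) (≡.sym (ℕ.+-suc c d)) l≥))
  far {l} (l≥ , inj₂ p) = ≡.subst (λ m → 2 + m ≤ l) (ℕ.+-suc c d) p
  spl : ∀ {x} → Configuration δ c (suc d) (suc (c + d)) x →
        Configuration δ c (suc (suc d)) (suc (c + d)) x ⊎
        ∃ λ y → Configuration δ (δ + c) (3 + d) (3 + (c + d)) y × x ≡ (suc d ∷ proj₁ y , proj₂ y)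
  spl (configuration [] g l s a) = inj₁ (configuration [] g l s a)
  spl {p ∷ P , _} (configuration (p≥ ∷ _) (p< ∷ g) l s (a ∷ as)) with ℕ.m≤n⇒m<n∨m≡n p≥
  ... | inj₁ p> = inj₁ (configuration
          (p> ∷ All.map (ℕ.≤-trans (ℕ.≤-trans (s≤s p≥) (ℕ.n≤1+n (suc p)))) p<) (p< ∷ g) l s (a ∷ as))
  ... | inj₂ refl = inj₂ (_ , configuration p< g (All.zipWith far (l , a)) s as , refl)

small-sum : ∀ {m xs} → All (m ≤_) xs → sum xs < m → xs ≡ []
small-sum []                  _    = refl
small-sum {xs = x ∷ xs} (m≤x ∷ _) sum<m = ⊥-elim (ℕ.<⇒≱ sum<m (ℕ.≤-trans m≤x (ℕ.m≤m+n x (sum xs))))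

small-weight : ∀ {δ c d e s x} → s < d → s < e → Configuration δ c d e x → weight x ≡ s → x ≡ ([] , [])
small-weight {x = P , L} s<d s<e k refl = ≡.cong₂ _,_
  (small-sum (P≥ k) (ℕ.≤-<-trans (ℕ.≤-trans (ℕ.m≤m+n (sum P) (sum P + 0)) (ℕ.m≤m+n (2 * sum P) (sum L))) s<d))
  (small-sum (L≥ k) (ℕ.≤-<-trans (ℕ.m≤n+m (sum L) (2 * sum P)) s<e))

small-level : ∀ δ c d e s → s < d → s < e → Level (Configuration δ c d e) s
small-level δ c d e zero s<d s<e = record
  { elements = ([] , []) ∷ []
  ; unique   = [] ∷ []
  ; sound    = λ { (here refl) → configuration [] [] [] [] [] , refl }
  ; complete = λ (k , w) → here (small-weight s<d s<e k w)
  }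
small-level δ c d e (suc s) s<d s<e = record
  { elements = []
  ; unique   = []
  ; sound    = λ ()
  ; complete = λ (k , w) → ⊥-elim (absurd (small-weight s<d s<e k w) w)
  }
  where
  absurd : ∀ {x} → x ≡ ([] , []) → ¬ weight x ≡ suc s
  absurd refl ()

private module Sums = Weighted sum

-- Enumerations of the two families of configurations

BF BH : ℕ → List ℕ × List ℕ → Set
BF d = Configuration 0 0 (suc d) d
BH d = Configuration 0 0 (suc d) (suc d)

fuel : ∀ {k d s} → s < suc k + d → s < k + suc d
fuel {k} {d} {s} p = ≡.subst (s <_) (≡.sym (ℕ.+-suc k d)) p

fuel₂ : ∀ {k d s} j → s < suc k + d → s ℕ.∸ j < k + suc (suc d)
fuel₂ {k} {d} {s} j p = ℕ.≤-<-trans (ℕ.m∸n≤m s j)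
  (ℕ.<-≤-trans (fuel {k} p) (ℕ.+-monoʳ-≤ k (ℕ.n≤1+n (suc d))))

-- The recursion runs on the distance from d up to s, not on the weight, which stays put in the
-- branch without a new part. Once `s < d` at most the empty configuration is left.
levelBF : ∀ k d s → s < k + d → Level (BF d) s
levelBH : ∀ k d s → s < k + d → Level (BH d) s
levelBF zero    d s p = small-level 0 0 (suc d) d s (ℕ.m<n⇒m<1+n p) p
levelBF (suc k) d s p = Step.level (L-step 0 0 d) s (levelBH (suc k) d s p)
  (λ _ → levelBF k (suc d) (s ℕ.∸ d) (ℕ.≤-<-trans (ℕ.m∸n≤m s d) (fuel {k} p)))
levelBH zero    d s p = small-level 0 0 (suc d) (suc d) s (ℕ.m<n⇒m<1+n p) (ℕ.m<n⇒m<1+n p)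
levelBH (suc k) d s p = Step.level (P-step 0 0 d) s (levelBF k (suc d) s (fuel {k} p))
  (λ _ → levelBH k (suc (suc d)) (s ℕ.∸ 2 * suc d) (fuel₂ {k} (2 * suc d) p))

CF CH : ℕ → ℕ → List ℕ × List ℕ → Set
CF c d = Configuration 1 c (suc d) (c + d)
CH c d = Configuration 1 c (suc d) (suc (c + d))

CF-step : ∀ c d → Step (CF c d) (CH c d) (CF c (suc d)) (c + d)
CF-step c d = ≡.subst (λ e → Step (CF c d) (CH c d) (Configuration 1 c (suc (suc d)) e) (c + d))
  (≡.sym (ℕ.+-suc c d)) (L-step 1 c d)

-- Since c + d + 3 = (c + 1) + (d + 2), the offset raised by δ = 1 absorbs the new bound on L and
-- the step leads back into the family `CF`. For δ = 0 the same step leads into `BH`, which is why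
-- the two recurrences differ in form.
CH-step : ∀ c d → Step (CH c d) (CF c (suc d)) (CF (suc c) (suc (suc d))) (2 * suc d)
CH-step c d = ≡.subst₂ (λ e e′ → Step (CH c d) (Configuration 1 c (suc (suc d)) e)
                                  (Configuration 1 (suc c) (3 + d) e′) (2 * suc d))
  (≡.sym (ℕ.+-suc c d)) (≡.cong suc (2+[c+d] c d)) (P-step 1 c d)

levelCF : ∀ k c d s → s < k + d → Level (CF c d) s
levelCH : ∀ k c d s → s < k + d → Level (CH c d) s
levelCF zero    c d s p = small-level 1 c (suc d) (c + d) s (ℕ.m<n⇒m<1+n p) (ℕ.<-≤-trans p (ℕ.m≤n+m d c))
levelCF (suc k) c d s p = Step.level (CF-step c d) s (levelCH (suc k) c d s p)
  (λ _ → levelCF k c (suc d) (s ℕ.∸ (c + d)) (ℕ.≤-<-trans (ℕ.m∸n≤m s (c + d)) (fuel {k} p)))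
levelCH zero    c d s p = small-level 1 c (suc d) (suc (c + d)) s (ℕ.m<n⇒m<1+n p)
  (ℕ.m<n⇒m<1+n (ℕ.<-≤-trans p (ℕ.m≤n+m d c)))
levelCH (suc k) c d s p = Step.level (CH-step c d) s (levelCF k c (suc d) s (fuel {k} p))
  (λ _ → levelCF k (suc c) (suc (suc d)) (s ℕ.∸ 2 * suc d) (fuel₂ {k} (2 * suc d) p))

enumBF : ∀ d s → Level (BF d) s
enumBF d s = levelBF (suc s) d s (ℕ.m≤m+n (suc s) d)

enumBH : ∀ d s → Level (BH d) s
enumBH d s = levelBH (suc s) d s (ℕ.m≤m+n (suc s) d)

enumCF : ∀ c d s → Level (CF c d) s
enumCF c d s = levelCF (suc s) c d s (ℕ.m≤m+n (suc s) d)

enumCH : ∀ c d s → Level (CH c d) s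
enumCH c d s = levelCH (suc s) c d s (ℕ.m≤m+n (suc s) d)

number-small : ∀ δ c d e s s<d s<e → + number (small-level δ c d e s s<d s<e) ≡ one s
number-small δ c d e zero    _ _ = refl
number-small δ c d e (suc s) _ _ = refl

series-small : ∀ {δ c d e N} (l : ∀ s → Level (Configuration δ c d e) s) → N ≤ d → N ≤ e →
               ∀ s → s < N → series l s ≡ one s
series-small {δ} {c} {d} {e} l N≤d N≤e s s<N = ≡.trans
  (≡.cong +_ (number-unique (l s) (small-level δ c d e s s<d s<e))) (number-small δ c d e s s<d s<e)
  where
  s<d = ℕ.<-≤-trans s<N N≤d
  s<e = ℕ.<-≤-trans s<N N≤e

-- Partitions into parts ≡ ±1, ±3 modulo 7

Allowed : ℕ → Set
Allowed p = p ≡± 1 [mod 7 ] ⊎ p ≡± 3 [mod 7 ]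

allowed? : Decidable Allowed
allowed? p = (p ≡±? 1 [mod 7 ]) ⊎-dec (p ≡±? 3 [mod 7 ])

7+-∣ : ∀ i → (+ 7) ℤ.∣ i → (+ 7) ℤ.∣ (+ 7 ℤ.+ i)
7+-∣ i 7∣i = Signed.∣⇒∣ᵤ {i = + 7 ℤ.+ i} (Signed.∣m∣n⇒∣m+n (Signed.∣-refl {+ 7}) (Signed.∣ᵤ⇒∣ {i = i} 7∣i))

7+-∣⁻ : ∀ i → (+ 7) ℤ.∣ (+ 7 ℤ.+ i) → (+ 7) ℤ.∣ i
7+-∣⁻ i 7∣7+i = Signed.∣⇒∣ᵤ {i = i} (Signed.∣m+n∣m⇒∣n {m = + 7} {n = i} (Signed.∣ᵤ⇒∣ {i = + 7 ℤ.+ i} 7∣7+i) (Signed.∣-refl {+ 7}))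

7+-mod : ∀ p b → (+ p) ≡ b [mod 7 ] → (+ (7 + p)) ≡ b [mod 7 ]
7+-mod p b = ≡.subst ((+ 7) ℤ.∣_) (≡.sym (ℤ.+-assoc (+ 7) (+ p) (ℤ.- b))) ∘ 7+-∣ ((+ p) ℤ.- b)

7+-mod⁻ : ∀ p b → (+ (7 + p)) ≡ b [mod 7 ] → (+ p) ≡ b [mod 7 ]
7+-mod⁻ p b = 7+-∣⁻ ((+ p) ℤ.- b) ∘ ≡.subst ((+ 7) ℤ.∣_) (ℤ.+-assoc (+ 7) (+ p) (ℤ.- b))

allowed-+7 : ∀ n p → Allowed p → Allowed (n * 7 + p)
allowed-+7 zero    p ok = ok
allowed-+7 (suc n) p ok =
  Sum.map (Sum.map (7+-mod m (+ 1)) (7+-mod m (ℤ.- (+ 1)))) (Sum.map (7+-mod m (+ 3)) (7+-mod m (ℤ.- (+ 3))))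
    (allowed-+7 n p ok)
  where m = n * 7 + p

allowed-+7⁻ : ∀ n p → Allowed (n * 7 + p) → Allowed p
allowed-+7⁻ zero    p ok = ok
allowed-+7⁻ (suc n) p ok = allowed-+7⁻ n p
  (Sum.map (Sum.map (7+-mod⁻ m (+ 1)) (7+-mod⁻ m (ℤ.- (+ 1)))) (Sum.map (7+-mod⁻ m (+ 3)) (7+-mod⁻ m (ℤ.- (+ 3)))) ok)
  where m = n * 7 + p

allowed-residue : ∀ r n → (r ≡ 0 ⊎ r ≡ 2 ⊎ r ≡ 3 ⊎ r ≡ 5) → Allowed (suc (r + n * 7))
allowed-residue r n r≡ = ≡.subst Allowed (ℕ.+-comm (n * 7) (suc r)) (allowed-+7 n (suc r) (ok r≡))
  where
  ok : ∀ {r} → (r ≡ 0 ⊎ r ≡ 2 ⊎ r ≡ 3 ⊎ r ≡ 5) → Allowed (suc r)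
  ok (inj₁ refl)               = from-yes (allowed? 1)
  ok (inj₂ (inj₁ refl))        = from-yes (allowed? 3)
  ok (inj₂ (inj₂ (inj₁ refl))) = from-yes (allowed? 4)
  ok (inj₂ (inj₂ (inj₂ refl))) = from-yes (allowed? 6)

forbidden-residue : ∀ r n → (r ≡ 1 ⊎ r ≡ 4 ⊎ r ≡ 6) → ¬ Allowed (suc (r + n * 7))
forbidden-residue r n r≡ = no′ r≡ ∘ allowed-+7⁻ n (suc r) ∘ ≡.subst Allowed (ℕ.+-comm (suc r) (n * 7))
  where
  no′ : ∀ {r} → (r ≡ 1 ⊎ r ≡ 4 ⊎ r ≡ 6) → ¬ Allowed (suc r)
  no′ (inj₁ refl)        = from-no (allowed? 2)
  no′ (inj₂ (inj₁ refl)) = from-no (allowed? 5)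
  no′ (inj₂ (inj₂ refl)) = from-no (allowed? 7)

record AF (m : ℕ) (π : List ℕ) : Set where
  constructor parts
  field
    isPartition : IsPartition π
    allowed     : All Allowed π
    at-most     : All (_≤ m) π

enumAF : ∀ m s → Sums.Level (AF m) s
enumAF m s = image id id
  (λ (p , a , b , w) → parts p a b , w) (λ (parts p a b , w) → _ , (p , a , b , w) , refl)
  (restrict (λ π → isPartition? π ×-dec All.all? allowed? π ×-dec All.all? (ℕ._≤? m) π ×-dec (sum π ℕ.≟ s))
     (partitions≤ s) (bounded-unique s s s) (λ (p , _ , _ , w) → partitions≤-complete p (ℕ.≤-reflexive w)))

descending : ∀ {x xs} → Linked ℕ._≥_ (x ∷ xs) → All (_≤ x) xs
descending lk with Linked⇒AllPairs (λ p q → ℕ.≤-trans q p) lk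
... | all≤ ∷ _ = all≤

linked-cons : ∀ {x xs} → All (_≤ x) xs → Linked ℕ._≥_ xs → Linked ℕ._≥_ (x ∷ xs)
linked-cons []      []       = [-]
linked-cons (p ∷ _) [-]      = p ∷ [-]
linked-cons (p ∷ _) (q ∷ lk) = p ∷ q ∷ lk

-- The largest permitted part m + 1 may be repeated, so removing one copy leads back to
-- `AF (suc m)`; this accounts for the factor 1/(1 - q^(m+1)).
A-step : ∀ m → Allowed (suc m) → Sums.Step (AF (suc m)) (AF m) (AF (suc m)) (suc m)
A-step m ok = record
  { f        = suc m ∷_
  ; f-inj    = ∷-injectiveʳ
  ; f-weight = λ _ → refl
  ; from-Q   = λ (parts p a b) → parts p a (All.map ℕ.m≤n⇒m≤1+n b)
  ; from-R   = λ (parts (pos , lk) a b) → parts (s≤s z≤n ∷ pos , linked-cons b lk) (ok ∷ a) (ℕ.≤-refl ∷ b)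
  ; split    = spl
  ; disjoint = λ { _ (parts _ _ (b ∷ _)) → ℕ.1+n≰n b }
  }
  where
  spl : ∀ {π} → AF (suc m) π → AF m π ⊎ ∃ λ σ → AF (suc m) σ × π ≡ suc m ∷ σ
  spl (parts p a []) = inj₁ (parts p a [])
  spl (parts (pos , lk) a (b ∷ bs)) with ℕ.m≤n⇒m<n∨m≡n b
  ... | inj₁ (s≤s x≤m) = inj₁ (parts (pos , lk) a (x≤m ∷ All.map (λ y≤x → ℕ.≤-trans y≤x x≤m) (descending lk)))
  ... | inj₂ refl = inj₂ (_ , parts (All.tail pos , Linked.tail lk) (All.tail a) bs , refl)

A-skip : ∀ m s → ¬ Allowed (suc m) → number (enumAF (suc m) s) ≡ number (enumAF m s)
A-skip m s no-part = ≡.trans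
  (number-unique (enumAF (suc m) s) (image id id
    (λ (parts p a b , w) → parts p a (All.map ℕ.m≤n⇒m≤1+n b) , w)
    (λ (parts p a b , w) → _ , (parts p a (All.zipWith lower (a , b)) , w) , refl) (enumAF m s)))
  (length-map id (Enumeration.elements (enumAF m s)))
  where
  lower : ∀ {x} → Allowed x × x ≤ suc m → x ≤ m
  lower (a , x≤) with ℕ.m≤n⇒m<n∨m≡n x≤
  ... | inj₁ (s≤s x≤m) = x≤m
  ... | inj₂ refl = ⊥-elim (no-part a)

A-zero : ∀ s → + number (enumAF 0 s) ≡ one s
A-zero zero    = ≡.cong +_ (number-unique (enumAF 0 0) (record
  { elements = [] ∷ []
  ; unique   = [] ∷ []
  ; sound    = λ { (here refl) → parts ([] , []) [] [] , refl }
  ; complete = λ { {[]} _ → here refl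
                 ; {x ∷ π} (parts (0<x ∷ _ , _) _ (x≤0 ∷ _) , _) → ⊥-elim (ℕ.<⇒≱ 0<x x≤0) }
  }))
A-zero (suc s) = ≡.cong +_ (number-unique (enumAF 0 (suc s)) (record
  { elements = []
  ; unique   = []
  ; sound    = λ ()
  ; complete = λ { {[]} (_ , ())
                 ; {x ∷ π} (parts (0<x ∷ _ , _) _ (x≤0 ∷ _) , _) → ⊥-elim (ℕ.<⇒≱ 0<x x≤0) }
  }))

-- Comparison of the generating functions modulo q^N

module _ (N : ℕ) where
  private R = TruncatedSeries N
  open CommutativeRing R using (_≈_; 1#; semiring) renaming (trans to ≈-trans; sym to ≈-sym)
  open Algebra.Properties.Semiring.Exp semiring
  open Monomials N using (indeterminate^N≈0)
  open Gordon R indeterminate N indeterminate^N≈0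
  open Identity R indeterminate N indeterminate^N≈0

  F-series H-series A-series : ℕ → Series
  F-series m = series (enumBF (suc m))
  H-series m = series (enumBH (suc m))
  A-series m = Sums.series (enumAF m)

  C-series : ℕ → ℕ → Series
  C-series c d = series (enumCF c d)

  B-solution : Solution (λ m → indeterminate ^ suc m) (λ m → (indeterminate ^ suc (suc m)) ^ 2) F-series H-series
  B-solution = record
    { F-step = λ m → step-series (L-step 0 0 (suc m)) N (enumBF (suc m)) (enumBH (suc m)) (enumBF (suc (suc m)))
    ; H-step = λ m → square-exponent (suc (suc m)) (H-series m) (F-series (suc m)) (H-series (suc (suc m)))
        (step-series (P-step 0 0 (suc m)) N (enumBH (suc m)) (enumBF (suc (suc m))) (enumBH (suc (suc (suc m)))))
    }

  f-large : ∀ m → N ≤ m → F-series m ≈ 1#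
  f-large m N≤m = series-small (enumBF (suc m)) (ℕ.m≤n⇒m≤1+n (ℕ.m≤n⇒m≤1+n N≤m)) (ℕ.m≤n⇒m≤1+n N≤m)

  h-large : ∀ m → N ≤ m → H-series m ≈ 1#
  h-large m N≤m = series-small (enumBH (suc m)) (ℕ.m≤n⇒m≤1+n (ℕ.m≤n⇒m≤1+n N≤m)) (ℕ.m≤n⇒m≤1+n (ℕ.m≤n⇒m≤1+n N≤m))

  A≈B : A-series (N * 7) ≈ F-series 0
  A≈B = gordon A-series (λ s _ → A-zero s)
    (λ r n r≡ → let m = r + n * 7 in isolate (indeterminate ^ suc m) (A-series (suc m)) (A-series m)
      (Sums.step-series (A-step m (allowed-residue r n r≡)) N (enumAF (suc m)) (enumAF m) (enumAF (suc m))))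
    (λ r n r≡ s _ → ≡.cong +_ (A-skip (r + n * 7) s (forbidden-residue r n r≡)))
    B-solution f-large h-large

  B≈C : F-series 0 ≈ C-series 0 1
  B≈C = G≈F C-series
    (λ c d → eliminate (suc d) (c + d) (C-series c d) (series (enumCH c d)) (C-series c (suc d)) (C-series (suc c) (suc (suc d)))
      (step-series (CF-step c d) N (enumCF c d) (enumCH c d) (enumCF c (suc d)))
      (step-series (CH-step c d) N (enumCH c d) (enumCF c (suc d)) (enumCF (suc c) (suc (suc d)))))
    (λ c d N≤d → series-small (enumCF c d) (ℕ.m≤n⇒m≤1+n N≤d) (ℕ.m≤n⇒m≤o+n c N≤d))
    B-solution f-large h-large

-- Translation to the definitions of A, B and C

All-reverse : ∀ {P : ℕ → Set} {xs} → All P xs → All P (reverse xs)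
All-reverse {xs = xs} = All-resp-↭ (↭-sym (↭-reverse xs))

All-reverse⁻ : ∀ {P : ℕ → Set} {xs} → All P (reverse xs) → All P xs
All-reverse⁻ {xs = xs} = All-resp-↭ (↭-reverse xs)

AllPairs-reverse : ∀ {R : Rel ℕ 0ℓ} {xs} → AllPairs R xs → AllPairs (flip R) (reverse xs)
AllPairs-reverse [] = []
AllPairs-reverse {R} {x ∷ xs} (px ∷ pxs) = ≡.subst (AllPairs (flip R)) (≡.sym (unfold-reverse x xs))
  (AllPairs.++⁺ (AllPairs-reverse pxs) ([] ∷ []) (All.map (_∷ []) (All-reverse px)))

AllPairs-reverse⁻ : ∀ {R : Rel ℕ 0ℓ} {xs} → AllPairs R (reverse xs) → AllPairs (flip R) xs
AllPairs-reverse⁻ {R} {xs} = ≡.subst (AllPairs (flip R)) (reverse-involutive xs) ∘ AllPairs-reverse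

fromHalves : List ℕ × List ℕ → List ℕ × List ℕ
fromHalves (P , L) = reverse (map (2 *_) P) , reverse L

fromHalves-injective : ∀ {x y} → fromHalves x ≡ fromHalves y → x ≡ y
fromHalves-injective eq = ≡.cong₂ _,_
  (map-injective (λ {a} {b} → ℕ.*-cancelˡ-≡ a b 2) (reverse-injective (≡.cong proj₁ eq)))
  (reverse-injective (≡.cong proj₂ eq))

double-half : ∀ {xs} → All (2 ∣_) xs → map (2 *_) (map (_/ 2) xs) ≡ xs
double-half []       = refl
double-half (d ∷ ds) = ≡.cong₂ _∷_ (m*[n/m]≡n d) (double-half ds)

half-double : ∀ f → 2 * f / 2 ≡ f
half-double f = ≡.trans (≡.cong (_/ 2) (ℕ.*-comm 2 f)) (m*n/n≡m f 2)

sum-double : ∀ P → sum (map (2 *_) P) ≡ 2 * sum P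
sum-double []      = refl
sum-double (f ∷ P) = ≡.trans (≡.cong (λ m → 2 * f + m) (sum-double P)) (≡.sym (ℕ.*-distribˡ-+ 2 f (sum P)))

sum-∪ : ∀ π σ → sum (π ∪ σ) ≡ sum π + sum σ
sum-∪ π σ = ≡.trans (sum-↭ (merge-↭ ℕ._≥?_ π σ)) (sum-++ π σ)

sum-fromHalves : ∀ P L → let (π , σ) = fromHalves (P , L) in sum (π ∪ σ) ≡ weight (P , L)
sum-fromHalves P L = ≡.trans (sum-∪ (reverse (map (2 *_) P)) (reverse L))
  (≡.cong₂ _+_ (≡.trans (sum-↭ (↭-reverse (map (2 *_) P))) (sum-double P)) (sum-↭ (↭-reverse L)))

∪-isPartition : ∀ {π σ} → IsPartition π → IsPartition σ → IsPartition (π ∪ σ)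
∪-isPartition {π} {σ} (pos , lk) (pos′ , lk′) =
  All-resp-↭ (↭-sym (merge-↭ ℕ._≥?_ π σ)) (All.++⁺ pos pos′) ,
  merge⁺ (Flip.decTotalOrder ℕ.≤-decTotalOrder) lk lk′

Clear : ℕ → List ℕ → Set
Clear g σ = g ∸ 1 ∉ σ × g ∉ σ × g + 1 ∉ σ

-- `Apart` expresses the exclusion without subtraction. At `g = 0` the truncated `g ∸ 1` merely
-- repeats the value g, so nothing extra is excluded.
apart⇒≢ : ∀ {g l} → Apart g l → g ∸ 1 ≢ l × g ≢ l × g + 1 ≢ l
apart⇒≢ {g} (inj₁ p) =
  (λ { refl → ℕ.<⇒≱ p (≤suc g) }) , (λ { refl → ℕ.<⇒≱ p (ℕ.n≤1+n g) }) ,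
  (λ { refl → ℕ.<⇒≱ p (ℕ.≤-trans (ℕ.m≤m+n g 1) (ℕ.n≤1+n (g + 1))) })
  where
  ≤suc : ∀ g → g ≤ suc (g ∸ 1)
  ≤suc zero    = z≤n
  ≤suc (suc g) = ℕ.≤-refl
apart⇒≢ {g} (inj₂ p) =
  (λ { refl → ℕ.<⇒≱ p (ℕ.≤-trans (ℕ.m∸n≤m g 1) (ℕ.n≤1+n g)) }) , (λ { refl → ℕ.<⇒≱ p (ℕ.n≤1+n g) }) ,
  (λ { refl → ℕ.<⇒≱ p (ℕ.≤-reflexive (ℕ.+-comm g 1)) })

≢⇒apart : ∀ {g l} → g ∸ 1 ≢ l → g ≢ l → g + 1 ≢ l → Apart g l
≢⇒apart {g} {l} g-1≢ g≢ g+1≢ with ℕ.<-cmp l g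
... | tri< l<g _ _ = inj₁ (ℕ.≤∧≢⇒< l<g (λ { refl → g-1≢ refl }))
... | tri≈ _ l≡g _ = ⊥-elim (g≢ (≡.sym l≡g))
... | tri> _ _ g<l = inj₂ (ℕ.≤∧≢⇒< g<l (λ { refl → g+1≢ (ℕ.+-comm g 1) }))

clear⇒apart : ∀ {g L} → Clear g (reverse L) → All (Apart g) L
clear⇒apart {g} {L} (n₁ , n₂ , n₃) = All-reverse⁻ {xs = L} (All.tabulate λ l∈ →
  ≢⇒apart (λ { refl → n₁ l∈ }) (λ { refl → n₂ l∈ }) (λ { refl → n₃ l∈ }))

apart⇒clear : ∀ {g L} → All (Apart g) L → Clear g (reverse L)
apart⇒clear {g} {L} as =
  (λ ∈σ → proj₁ (ne ∈σ) refl) , (λ ∈σ → proj₁ (proj₂ (ne ∈σ)) refl) , (λ ∈σ → proj₂ (proj₂ (ne ∈σ)) refl)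
  where
  ne : ∀ {l} → l ∈ reverse L → g ∸ 1 ≢ l × g ≢ l × g + 1 ≢ l
  ne l∈ = apart⇒≢ (All.lookup (All-reverse as) l∈)

shift-offset : ∀ δ c i x → c + (δ * suc i + x) ≡ (δ + c) + (δ * i + x)
shift-offset = solve 4 (λ δ c i x → c :+ (δ :* (con 1 :+ i) :+ x) := (δ :+ c) :+ (δ :* i :+ x)) refl
  where open +-*-Solver

first-offset : ∀ δ c f → c + (δ * 0 + 2 * f / 2) ≡ c + f
first-offset δ c f = ≡.cong (λ m → c + m) (≡.cong₂ _+_ (ℕ.*-zeroʳ δ) (half-double f))

-- The offset c is general for the induction: in the tail of P every index drops by one, and the δ
-- lost there moves into c.
clear⇒avoids : ∀ δ c P L →
  (∀ (i : Fin (length (map (2 *_) P))) → Clear (c + (δ * toℕ i + lookup (map (2 *_) P) i / 2)) (reverse L)) →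
  Avoids δ c P L
clear⇒avoids δ c []      L cl = []
clear⇒avoids δ c (f ∷ P) L cl =
  clear⇒apart (≡.subst (λ g → Clear g (reverse L)) (first-offset δ c f) (cl Fin.zero)) ∷
  clear⇒avoids δ (δ + c) P L λ i →
    ≡.subst (λ g → Clear g (reverse L)) (shift-offset δ c (toℕ i) _) (cl (Fin.suc i))

avoids⇒clear : ∀ δ c P L → Avoids δ c P L →
  ∀ (i : Fin (length (map (2 *_) P))) → Clear (c + (δ * toℕ i + lookup (map (2 *_) P) i / 2)) (reverse L)
avoids⇒clear δ c (f ∷ P) L (a ∷ as) Fin.zero =
  ≡.subst (λ g → Clear g (reverse L)) (≡.sym (first-offset δ c f)) (apart⇒clear a)
avoids⇒clear δ c (f ∷ P) L (a ∷ as) (Fin.suc i) =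
  ≡.subst (λ g → Clear g (reverse L)) (≡.sym (shift-offset δ c (toℕ i) _)) (avoids⇒clear δ (δ + c) P L as i)

ClearAt : ℕ → List ℕ → List ℕ → Set
ClearAt δ xs σ = ∀ (i : Fin (length xs)) → Clear (δ * toℕ i + lookup xs i / 2) σ

-- A common form of both conditions. At δ = 0 it unfolds to `IsB`; at δ = 1 it differs from `IsC`
-- only in the arrangement of the sums and truncated subtractions, which `Clear-C` handles with j =
-- i + 1.
IsBipartitionOfKind : ℕ → ℕ → List ℕ × List ℕ → Set
IsBipartitionOfKind δ n (π , σ) =
  (π , σ) IsBipartitionOf n × EvenGapped π × DistinctParts σ × ClearAt δ (ascending π) σ

fromConfiguration : ∀ {δ n x} → Configuration δ 0 2 1 x × weight x ≡ n → IsBipartitionOfKind δ n (fromHalves x)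
fromConfiguration {δ} {n} {P , L} (configuration P≥ gaps L≥ strict avoids , w) =
  (π-partition , σ-partition , ∪-isPartition π-partition σ-partition , ≡.trans (sum-fromHalves P L) w) ,
  (AllPairs.map (λ b<a a≡b → ℕ.<⇒≢ b<a (≡.sym a≡b)) π-strict , All-reverse (All.map⁺ (All.universal (λ f → m∣m*n f) P)) ,
   All-reverse (All.map⁺ (All.map (λ {f} 2≤f → ℕ.<-≤-trans (s≤s (s≤s (s≤s z≤n))) (ℕ.*-monoʳ-≤ 2 2≤f)) P≥)) ,
   AllPairs⇒Linked π-gaps) ,
  AllPairs.map (λ b<a a≡b → ℕ.<⇒≢ b<a (≡.sym a≡b)) σ-strict ,
  ≡.subst (λ xs → ClearAt δ xs (reverse L)) (≡.sym (reverse-involutive (map (2 *_) P))) (avoids⇒clear δ 0 P L avoids)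
  where
  double-gap : ∀ {a b} → 2 + a ≤ b → 2 * a + 4 ≤ 2 * b
  double-gap {a} {b} p = ≡.subst (_≤ 2 * b) (≡.trans (ℕ.*-distribˡ-+ 2 2 a) (ℕ.+-comm 4 (2 * a))) (ℕ.*-monoʳ-≤ 2 p)
  π-gaps : AllPairs (λ a b → b + 4 ≤ a) (reverse (map (2 *_) P))
  π-gaps = AllPairs-reverse (AllPairs.map⁺ (AllPairs.map double-gap gaps))
  π-strict : AllPairs ℕ._>_ (reverse (map (2 *_) P))
  π-strict = AllPairs.map (λ {a} {b} → ℕ.≤-trans (≡.subst (_≤ b + 4) (ℕ.+-comm b 1) (ℕ.+-monoʳ-≤ b (s≤s z≤n)))) π-gaps
  σ-strict : AllPairs ℕ._>_ (reverse L)
  σ-strict = AllPairs-reverse strict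
  π-partition : IsPartition (reverse (map (2 *_) P))
  π-partition = All-reverse (All.map⁺ (All.map (λ {f} 2≤f → ℕ.<-≤-trans (s≤s z≤n) (ℕ.*-monoʳ-≤ 2 2≤f)) P≥)) ,
                AllPairs⇒Linked (AllPairs.map ℕ.<⇒≤ π-strict)
  σ-partition : IsPartition (reverse L)
  σ-partition = All-reverse L≥ , AllPairs⇒Linked (AllPairs.map ℕ.<⇒≤ σ-strict)

toConfiguration : ∀ {δ n P L} → IsBipartitionOfKind δ n (fromHalves (P , L)) →
                  Configuration δ 0 2 1 (P , L) × weight (P , L) ≡ n
toConfiguration {δ} {n} {P} {L} ((_ , (σ-pos , σ-lk) , _ , w) , (_ , _ , >2 , lk) , σ-distinct , clear) =
  configuration
    (All.map (λ {f} p → ℕ.*-cancelˡ-< 2 1 f p) (All.map⁻ (All-reverse⁻ {xs = map (2 *_) P} >2)))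
    (AllPairs.map halve-gap (AllPairs.map⁻ {f = 2 *_} (AllPairs-reverse⁻ {xs = map (2 *_) P} (Linked⇒AllPairs gap-trans lk))))
    (All-reverse⁻ {xs = L} σ-pos)
    (AllPairs-reverse⁻ {xs = L} (AllPairs.zipWith (λ (b≤a , a≢b) → ℕ.≤∧≢⇒< b≤a (a≢b ∘ ≡.sym))
      (Linked⇒AllPairs (λ p q → ℕ.≤-trans q p) σ-lk , σ-distinct)))
    (clear⇒avoids δ 0 P L (≡.subst (λ xs → ClearAt δ xs (reverse L)) (reverse-involutive (map (2 *_) P)) clear)) ,
  ≡.trans (≡.sym (sum-fromHalves P L)) w
  where
  gap-trans : ∀ {a b c} → b + 4 ≤ a → c + 4 ≤ b → c + 4 ≤ a
  gap-trans {a} {b} p q = ℕ.≤-trans q (ℕ.≤-trans (ℕ.m≤m+n b 4) p)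
  halve-gap : ∀ {a b} → 2 * a + 4 ≤ 2 * b → 2 + a ≤ b
  halve-gap {a} {b} p = ℕ.*-cancelˡ-≤ 2
    (≡.subst (_≤ 2 * b) (≡.trans (ℕ.+-comm (2 * a) 4) (≡.sym (ℕ.*-distribˡ-+ 2 2 a))) p)

halves : ∀ {δ n x} → IsBipartitionOfKind δ n x →
         ∃ λ y → (Configuration δ 0 2 1 y × weight y ≡ n) × x ≡ fromHalves y
halves {δ} {n} {π , σ} k@(_ , (_ , even , _) , _) =
  y , toConfiguration {P = proj₁ y} {L = proj₂ y} (≡.subst (IsBipartitionOfKind δ n) eq k) , eq
  where
  y = map (_/ 2) (reverse π) , reverse σ
  eq : (π , σ) ≡ fromHalves y
  eq = ≡.cong₂ _,_
    (≡.sym (≡.trans (≡.cong reverse (double-half (All-reverse even))) (reverse-involutive π)))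
    (≡.sym (reverse-involutive σ))

enumKind : ∀ δ n → Enumeration (λ x → Configuration δ 0 2 1 x × weight x ≡ n) → Enumeration (IsBipartitionOfKind δ n)
enumKind δ n = image fromHalves fromHalves-injective fromConfiguration halves

number-enumKind : ∀ δ n e → number (enumKind δ n e) ≡ number e
number-enumKind δ n e = length-map fromHalves (Enumeration.elements e)

Clear-C : ∀ i x σ → (x + suc i ∸ 2 ∉ σ × x + suc i ∸ 1 ∉ σ × x + suc i ∉ σ) ≡ Clear (1 * i + x) σ
Clear-C i x σ = ≡.cong₂ _×_ (≡.cong (λ m → m ∸ 2 ∉ σ) eq)
  (≡.cong₂ _×_ (≡.cong (λ m → m ∸ 1 ∉ σ) eq) (≡.cong (_∉ σ) (≡.trans eq (ℕ.+-comm 1 (1 * i + x)))))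
  where
  eq : x + suc i ≡ suc (1 * i + x)
  eq = ≡.trans (ℕ.+-suc x i) (≡.cong suc (≡.trans (ℕ.+-comm x i) (≡.cong (λ m → m + x) (≡.sym (ℕ.*-identityˡ i)))))

-- The counts as coefficients

All-≤sum : ∀ xs → All (_≤ sum xs) xs
All-≤sum []       = []
All-≤sum (x ∷ xs) = ℕ.m≤m+n x (sum xs) ∷ All.map (λ p → ℕ.≤-trans p (ℕ.m≤n+m (sum xs) x)) (All-≤sum xs)

A-number : ∀ n m → n ≤ m → A n ≡ number (enumAF m n)
A-number n m n≤m = ≡.trans
  (number-unique (enumA n) (image id id
    (λ (parts p a _ , w) → (p , w) , a)
    (λ { {π} ((p , refl) , a) → _ , (parts p a (All.map (λ q → ℕ.≤-trans q n≤m) (All-≤sum π)) , refl) , refl })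
    (enumAF m n)))
  (length-map id (Enumeration.elements (enumAF m n)))

B-number : ∀ n → B n ≡ number (enumBF 1 n)
B-number n = ≡.trans (number-unique (enumB n) (enumKind 0 n (enumBF 1 n))) (number-enumKind 0 n (enumBF 1 n))

C-number : ∀ n → C n ≡ number (enumCF 0 1 n)
C-number n = ≡.trans
  (number-unique (enumC n) (image id id
    (λ {πσ} (b , e , d , c) → b , e , d , λ i → ≡.subst id (≡.sym (clear πσ i)) (c i))
    (λ {πσ} (b , e , d , c) → πσ , (b , e , d , λ i → ≡.subst id (clear πσ i) (c i)) , refl)
    kind))
  (≡.trans (length-map id (Enumeration.elements kind)) (number-enumKind 1 n (enumCF 0 1 n)))
  where
  kind = enumKind 1 n (enumCF 0 1 n)
  clear = λ (πσ : List ℕ × List ℕ) i →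
    Clear-C (toℕ i) (lookup (reverse (proj₁ πσ)) i / 2) (proj₂ πσ)

theorem9 : ∀ (n : ℕ) → .{{_ : NonZero n}} → A n ≡ B n × B n ≡ C n
theorem9 n =
  -- Modulo q^(n+1) the coefficient of q^n is still visible. The bound 7(n+1) on the parts comes
  -- from the product side and is harmless, since no part of a partition of n exceeds n.
  ≡.trans (A-number n (suc n * 7) (ℕ.≤-trans (ℕ.n≤1+n n) (ℕ.m≤m*n (suc n) 7)))
    (≡.trans (ℤ.+-injective (A≈B (suc n) n ℕ.≤-refl)) (≡.sym (B-number n))) ,
  ≡.trans (B-number n) (≡.trans (ℤ.+-injective (B≈C (suc n) n ℕ.≤-refl)) (≡.sym (C-number n)))
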